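{- Let $H$ be a graph such that the class $\mathcal{F}_H$ of all graphs with no induced subgraph isomorphic to $H$ is clean. Then $H$ is a subdivided star forest.
   Context: All graphs are finite and simple. For an integer $t\geq 1$, the $t$-basic obstructions are: $K_t$, $K_{t,t}$, every subdivision of the $(t\times t)$-wall $W_{t\times t}$, and the line graph of every subdivision of $W_{t\times t}$, where $W_{t\times t}$ is the standard $(t\times t)$-wall (a planar hexagonal-grid-like graph of maximum degree three on $2t^2-2t$ vertices). A graph is $t$-clean if it has no induced subgraph isomorphic to a $t$-basic obstruction. A class $\mathcal{C}$ of graphs is clean if for every positive integer $t$ there exists $w(t)$ such that every $t$-clean graph in $\mathcal{C}$ has treewidth at most $w(t)$. A subdivided star forest is a forest in which every component is a tree with at most one vertex of degree more than two. -}

module Defs where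

open import Data.Nat using (ℕ; zero; suc; _+_; _*_; _∸_; _≤_; _%_)
open import Data.Nat.Properties using (1+n≢n)
open import Data.Fin using (Fin; toℕ; inject₁; fromℕ)
import Data.Fin as F
open import Data.Product using (Σ; ∃; _×_; _,_; proj₁; proj₂; swap)
open import Data.Sum using (_⊎_; inj₁; inj₂)
open import Data.Maybe using (Maybe; just; nothing)
open import Data.Empty using (⊥)
open import Data.Unit using (⊤)
open import Data.List using (List; length)
open import Data.List.Membership.Propositional using (_∈_)
open import Relation.Nullary using (¬_)
open import Relation.Binary.PropositionalEquality using (_≡_; _≢_; refl; sym)
open import Function.Bundles using (_↔_; _⇔_)
open import Function.Definitions using (Injective)

-- Simple graphs: a vertex type with a symmetric irreflexive adjacency.
-- Finiteness is a separate predicate (obstruction graphs are built on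
-- convenient vertex types; all graphs in the theorem are required finite).

record Graph : Set₁ where
  field
    V     : Set
    E     : V → V → Set
    E-sym : ∀ {u v} → E u v → E v u
    E-irr : ∀ {v} → ¬ E v v
open Graph public

Finite : Graph → Set
Finite G = Σ ℕ λ n → Fin n ↔ V G

Embeds : Graph → Graph → Set
Embeds H G = Σ (V H → V G) λ f →
  Injective _≡_ _≡_ f × (∀ u v → E H u v ⇔ E G (f u) (f v))

WalkWithin : (G : Graph) → (V G → Set) → V G → V G → Set
WalkWithin G P x y = Σ ℕ λ m → Σ (Fin (suc m) → V G) λ p →
  p F.zero ≡ x × p (fromℕ m) ≡ y × (∀ i → P (p i)) ×
  (∀ (i : Fin m) → E G (p (inject₁ i)) (p (F.suc i)))

Reachable : (G : Graph) → V G → V G → Set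
Reachable G = WalkWithin G (λ _ → ⊤)

Acyclic : Graph → Set
Acyclic G = ∀ m (p : Fin (suc m) → V G) → 2 ≤ m → Injective _≡_ _≡_ p →
  (∀ (i : Fin m) → E G (p (inject₁ i)) (p (F.suc i))) → ¬ E G (p (fromℕ m)) (p F.zero)

IsTree : Graph → Set
IsTree T = Finite T × V T × (∀ x y → Reachable T x y) × Acyclic T

DegGt2 : (G : Graph) → V G → Set
DegGt2 G v = Σ (V G) λ a → Σ (V G) λ b → Σ (V G) λ c →
  E G v a × E G v b × E G v c × a ≢ b × a ≢ c × b ≢ c

SubdividedStarForest : Graph → Set
SubdividedStarForest G = Acyclic G ×
  (∀ u v → DegGt2 G u → DegGt2 G v → Reachable G u v → u ≡ v)

record TreeDecomposition (G : Graph) : Set₁ where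
  field
    T       : Graph
    T-tree  : IsTree T
    bag     : V T → List (V G)
    cover-v : ∀ v → Σ (V T) λ x → v ∈ bag x
    cover-e : ∀ u v → E G u v → Σ (V T) λ x → u ∈ bag x × v ∈ bag x
    conn    : ∀ v x y → v ∈ bag x → v ∈ bag y → WalkWithin T (λ z → v ∈ bag z) x y
open TreeDecomposition public

TreewidthAtMost : Graph → ℕ → Set₁
TreewidthAtMost G w = Σ (TreeDecomposition G) λ D → ∀ x → length (bag D x) ≤ suc w

Complete : ℕ → Graph
Complete t = record { V = Fin t ; E = λ u v → u ≢ v
                    ; E-sym = λ p q → p (sym q) ; E-irr = λ p → p refl }

private
  KE : ∀ {t} → Fin t ⊎ Fin t → Fin t ⊎ Fin t → Set
  KE (inj₁ _) (inj₂ _) = ⊤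
  KE (inj₂ _) (inj₁ _) = ⊤
  KE (inj₁ _) (inj₁ _) = ⊥
  KE (inj₂ _) (inj₂ _) = ⊥

  KE-sym : ∀ {t} {u v : Fin t ⊎ Fin t} → KE u v → KE v u
  KE-sym {u = inj₁ _} {inj₂ _} _ = _
  KE-sym {u = inj₂ _} {inj₁ _} _ = _

  KE-irr : ∀ {t} {v : Fin t ⊎ Fin t} → ¬ KE v v
  KE-irr {v = inj₁ _} ()
  KE-irr {v = inj₂ _} ()

CompleteBipartite : ℕ → Graph
CompleteBipartite t = record { V = Fin t ⊎ Fin t ; E = KE ; E-sym = KE-sym ; E-irr = KE-irr }

-- The (t × t)-wall.  Start from t rows (indexed i = 0 … t-1), each a path on
-- 2t vertices (columns j = 0 … 2t-1); add the vertical edge (i,j)(i+1,j)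
-- whenever i + j is even; finally delete the two vertices of degree one
-- (the "corners" (0,2t-1) and (t-1,0) or (t-1,2t-1) according to the parity of t).

Even : ℕ → Set
Even n = n % 2 ≡ 0

WallCorner : (t : ℕ) → Fin t → Fin (2 * t) → Set
WallCorner t i j = (toℕ i ≡ 0 × toℕ j ≡ 2 * t ∸ 1)
                 ⊎ (toℕ i ≡ t ∸ 1 × ((t % 2 ≡ 1 × toℕ j ≡ 0) ⊎ (t % 2 ≡ 0 × toℕ j ≡ 2 * t ∸ 1)))

WallVertex : ℕ → Set
WallVertex t = Σ (Fin t × Fin (2 * t)) λ p → ¬ WallCorner t (proj₁ p) (proj₂ p)

WallAdjℕ : ℕ → ℕ → ℕ → ℕ → Set
WallAdjℕ i j k l = (i ≡ k × (suc j ≡ l ⊎ suc l ≡ j))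
                 ⊎ (j ≡ l × ((suc i ≡ k × Even (i + j)) ⊎ (suc k ≡ i × Even (k + l))))

private
  WallAdjℕ-sym : ∀ {i j k l} → WallAdjℕ i j k l → WallAdjℕ k l i j
  WallAdjℕ-sym (inj₁ (refl , inj₁ e)) = inj₁ (refl , inj₂ e)
  WallAdjℕ-sym (inj₁ (refl , inj₂ e)) = inj₁ (refl , inj₁ e)
  WallAdjℕ-sym (inj₂ (refl , inj₁ e)) = inj₂ (refl , inj₂ e)
  WallAdjℕ-sym (inj₂ (refl , inj₂ e)) = inj₂ (refl , inj₁ e)

  WallAdjℕ-irr : ∀ {i j} → ¬ WallAdjℕ i j i j
  WallAdjℕ-irr {i} {j} (inj₁ (_ , inj₁ e)) = 1+n≢n e
  WallAdjℕ-irr {i} {j} (inj₁ (_ , inj₂ e)) = 1+n≢n e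
  WallAdjℕ-irr {i} {j} (inj₂ (_ , inj₁ (e , _))) = 1+n≢n e
  WallAdjℕ-irr {i} {j} (inj₂ (_ , inj₂ (e , _))) = 1+n≢n e

WallAdj : ∀ t → WallVertex t → WallVertex t → Set
WallAdj t ((i , j) , _) ((k , l) , _) = WallAdjℕ (toℕ i) (toℕ j) (toℕ k) (toℕ l)

Wall : ℕ → Graph
Wall t = record { V = WallVertex t ; E = WallAdj t
                ; E-sym = WallAdjℕ-sym ; E-irr = WallAdjℕ-irr }

private
  SameEnds : {A : Set} → A → A → A → A → Set
  SameEnds a b u v = (a ≡ u × b ≡ v) ⊎ (a ≡ v × b ≡ u)

  swapEnds : {A : Set} {a b u v : A} → SameEnds a b u v → SameEnds b a u v
  swapEnds (inj₁ (p , q)) = inj₂ (q , p)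
  swapEnds (inj₂ (p , q)) = inj₁ (q , p)

SubE : (G : Graph) → V G → V G → Maybe (V G) → Maybe (V G) → Set
SubE G u v (just a) (just b) = E G a b × ¬ SameEnds a b u v
SubE G u v nothing  (just a) = a ≡ u ⊎ a ≡ v
SubE G u v (just a) nothing  = a ≡ u ⊎ a ≡ v
SubE G u v nothing  nothing  = ⊥

private
  SubE-sym : (G : Graph) (u v : V G) {x y : Maybe (V G)} → SubE G u v x y → SubE G u v y x
  SubE-sym G u v {just a} {just b} (e , ne) = E-sym G e , λ s → ne (swapEnds s)
  SubE-sym G u v {nothing} {just a} e = e
  SubE-sym G u v {just a} {nothing} e = e

  SubE-irr : (G : Graph) (u v : V G) {x : Maybe (V G)} → ¬ SubE G u v x x
  SubE-irr G u v {just a} (e , _) = E-irr G e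
  SubE-irr G u v {nothing} ()

subdivideEdge : (G : Graph) (u v : V G) → E G u v → Graph
subdivideEdge G u v _ = record { V = Maybe (V G) ; E = SubE G u v
                               ; E-sym = SubE-sym G u v ; E-irr = SubE-irr G u v }

-- S is a subdivision of G: obtained from G by finitely many edge subdivisions
-- (up to isomorphism, which is irrelevant below as we only use Embeds).
data SubdivisionOf (G : Graph) : Graph → Set₁ where
  base : SubdivisionOf G G
  step : ∀ {S} → SubdivisionOf G S → (u v : V S) (e : E S u v) →
         SubdivisionOf G (subdivideEdge S u v e)

Share : {A : Set} → A × A → A × A → Set
Share (a , b) (c , d) = a ≡ c ⊎ a ≡ d ⊎ b ≡ c ⊎ b ≡ d

SameEdge : {A : Set} → A × A → A × A → Set
SameEdge (a , b) (c , d) = (a ≡ c × b ≡ d) ⊎ (a ≡ d × b ≡ c)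

record IsLineGraphOf (S L : Graph) : Set where
  field
    ends   : V L → V S × V S
    isEdge : ∀ x → E S (proj₁ (ends x)) (proj₂ (ends x))
    onto   : ∀ a b → E S a b → Σ (V L) λ x → SameEdge (ends x) (a , b)
    inj    : ∀ x y → SameEdge (ends x) (ends y) → x ≡ y
    adj    : ∀ x y → E L x y ⇔ (x ≢ y × Share (ends x) (ends y))

Clean : ℕ → Graph → Set₁
Clean t G = ¬ Embeds (Complete t) G
          × ¬ Embeds (CompleteBipartite t) G
          × (∀ S → SubdivisionOf (Wall t) S → ¬ Embeds S G)
          × (∀ S L → SubdivisionOf (Wall t) S → IsLineGraphOf S L → ¬ Embeds L G)

CleanClass : (Graph → Set) → Set₁
CleanClass 𝒞 = ∀ t → 1 ≤ t → Σ ℕ λ w →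
  ∀ G → Finite G → 𝒞 G → Clean t G → TreewidthAtMost G w

Free : Graph → Graph → Set
Free H G = ¬ Embeds H G

{-# OPTIONS --safe #-}
-- Pohoata–Davies arrays: n long paths ("rows") and n hubs, the j-th hub being adjacent to the j-th
-- block of s + 1 consecutive vertices of every row, where s ∈ {0, 1} and blocks start L apart.
-- * Treewidth ≥ n: the sets "row i plus hub j" form a bramble.
-- * An induced subgraph of bounded degree meets the block of any hub it contains in few vertices, so
--   that hub and its neighbours are a small cut between left and right, and every fork or triangle
--   lies in such a cut.  The crosses of a subdivided wall, or of its line graph, pairwise meet in
--   forks (triangles), so by the Helly property of intervals a single small cut would meet all crosses.
-- * For s = 0 there is no cycle of length ≤ L, so H is acyclic.  For s = 1 only hubs are centres of
--   induced claws and two hubs are at distance ≥ L, so a component of H has at most one branch vertex.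
module Submission where

open import Defs
open import Data.Bool using (Bool; true; false)
open import Data.Empty using (⊥; ⊥-elim)
open import Data.Fin using (Fin; toℕ; fromℕ; fromℕ<; inject₁; _↑ˡ_)
import Data.Fin as F
import Data.Fin.Properties as FP
open import Data.Fin.Relation.Unary.Top using (view; ‵fromℕ; ‵inject₁)
open import Data.List using (List; length; lookup)
open import Data.List.Membership.Propositional using (_∈_)
open import Data.List.Relation.Unary.Any using (index)
import Data.List.Relation.Unary.Any.Properties as AnyP
open import Data.Maybe using (just; nothing)
open import Data.Maybe.Properties using (just-injective)
open import Data.Nat
open import Data.Nat.Induction using (<-rec)
open import Data.Nat.Properties
open import Data.Product using (Σ; ∃; ∃₂; _×_; _,_; proj₁; proj₂; map₂)
open import Data.Sum using (_⊎_; inj₁; inj₂; [_,_]′)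
open import Data.Sum.Function.Propositional using (_⊎-↔_)
open import Data.Sum.Properties using (inj₁-injective; inj₂-injective)
open import Data.Unit using (⊤)
open import Function using (_∘_)
open import Function.Bundles using (Inverse; Equivalence)
open import Function.Construct.Composition using (_↔-∘_)
open import Function.Construct.Identity using (↔-id)
open import Function.Definitions using (Injective)
open import Relation.Binary using (DecidableEquality; tri<; tri≈; tri>)
open import Relation.Binary.Construct.Closure.ReflexiveTransitive using (Star; ε; _◅_; _◅◅_)
import Relation.Binary.Construct.Closure.ReflexiveTransitive as Star
open import Relation.Binary.PropositionalEquality
open import Relation.Nullary
open import Relation.Nullary.Decidable using (_×-dec_; _⊎-dec_; ¬¬-excluded-middle)

-- Brambles and tree decompositions

-- `CleanClass` fixes `w` once `t` is fixed, so a single `t` has to make every array clean, whatever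
-- `n`, `L` and `s`; then `n = 2 + w` refutes the bound as soon as `H` embeds in no array for some
-- `L` and `s`. The spacing `L` is chosen after `H`, larger than the cycle or walk to be excluded.
-- The two values of `s` serve different ends: for `s = 0` a cell inside a row that is adjacent to a
-- hub is itself the centre of an induced claw, while for `s = 1` triangles destroy these claws.
-- Acyclicity of `H` therefore comes first, and it keeps such triangles out of the image of `H` in
-- the second step. Every use of an obstruction ends in `⊥`, so facts about subdivided walls and
-- their line graphs may hold up to double negation only.

Within : (G : Graph) → (V G → Set) → V G → V G → Set
Within G P x y = E G x y × P x × P y

Within-sym : ∀ G {P x y} → Within G P x y → Within G P y x
Within-sym G (e , p , q) = E-sym G e , q , p

walk⇒star : ∀ {G P x y} → WalkWithin G P x y → Star (Within G P) x y
walk⇒star {G} {P} (m , p , refl , refl , inP , edge) = go m p inP edge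
  where
  go : ∀ m (p : Fin (suc m) → V G) → (∀ i → P (p i)) →
       (∀ (i : Fin m) → E G (p (inject₁ i)) (p (F.suc i))) →
       Star (Within G P) (p F.zero) (p (fromℕ m))
  go zero p inP edge = ε
  go (suc m) p inP edge =
    (edge F.zero , inP F.zero , inP (F.suc F.zero)) ◅ go m (p ∘ F.suc) (inP ∘ F.suc) (edge ∘ F.suc)

finite⇒≟ : ∀ {G} → Finite G → DecidableEquality (V G)
finite⇒≟ (n , fin) x y with Inverse.from fin x FP.≟ Inverse.from fin y
... | yes eq = yes (trans (sym (Inverse.strictlyInverseˡ fin x))
                   (trans (cong (Inverse.to fin) eq) (Inverse.strictlyInverseˡ fin y)))
... | no neq = no (neq ∘ cong (Inverse.from fin))

module _ {A : Set} (R : A → A → Set) where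

  record SimplePath (x y : A) : Set where
    constructor simplePath
    field
      len   : ℕ
      pt    : Fin (suc len) → A
      start : pt F.zero ≡ x
      end   : pt (fromℕ len) ≡ y
      inj   : Injective _≡_ _≡_ pt
      edge  : ∀ (i : Fin len) → R (pt (inject₁ i)) (pt (F.suc i))

module _ {A : Set} {R : A → A → Set} where

  suffix : ∀ {x y} (π : SimplePath R x y) i → SimplePath R (SimplePath.pt π i) y
  suffix (simplePath m p s t inj edge) F.zero = simplePath m p refl t inj edge
  suffix (simplePath (suc m) p s t inj edge) (F.suc i) =
    suffix (simplePath m (p ∘ F.suc) refl t (FP.suc-injective ∘ inj) (edge ∘ F.suc)) i

  prepend : ∀ {x y z} → R x y → (π : SimplePath R y z) → (∀ i → SimplePath.pt π i ≢ x) →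
            SimplePath R x z
  prepend {x} r (simplePath m p refl t inj edge) fresh =
    simplePath (suc m) q refl t inj′ edge′
    where
    q : Fin (suc (suc m)) → A
    q F.zero = x
    q (F.suc i) = p i
    inj′ : Injective _≡_ _≡_ q
    inj′ {F.zero} {F.zero} _ = refl
    inj′ {F.zero} {F.suc j} eq = ⊥-elim (fresh j (sym eq))
    inj′ {F.suc i} {F.zero} eq = ⊥-elim (fresh i eq)
    inj′ {F.suc i} {F.suc j} eq = cong F.suc (inj eq)
    edge′ : ∀ (i : Fin (suc m)) → R (q (inject₁ i)) (q (F.suc i))
    edge′ F.zero = r
    edge′ (F.suc i) = edge i

  eraseLoops : DecidableEquality A → ∀ {x y} → Star R x y → SimplePath R x y
  eraseLoops _≟A_ {x} ε = simplePath 0 (λ _ → x) refl refl (λ { {F.zero} {F.zero} _ → refl }) λ ()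
  eraseLoops _≟A_ {x} {y} (r ◅ w) with eraseLoops _≟A_ w
  ... | π with FP.any? (λ i → SimplePath.pt π i ≟A x)
  ...   | yes (i , eq) = subst (λ z → SimplePath R z y) eq (suffix π i)
  ...   | no fresh = prepend r π (λ i eq → fresh (i , eq))

  -- Cutting a walk after its last visit to `x` leaves a tail that avoids `x`. In a tree the first
  -- step of that tail tells which branch at `x` contains `z`.
  lastDeparture : DecidableEquality A → ∀ {x z} → Star R x z → x ≢ z →
                  ∃ λ y → R x y × Star (λ a b → R a b × a ≢ x × b ≢ x) y z
  lastDeparture _≟A_ {x} w x≢z = go x≢z w
    where
    Off : A → A → Set
    Off a b = R a b × a ≢ x × b ≢ x
    scan : ∀ {a z} → x ≢ z → Star R a z → (∃ λ y → R x y × Star Off y z) ⊎ (a ≢ x × Star Off a z)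
    scan {a} x≢z ε = inj₂ (x≢z ∘ sym , ε)
    scan {a} x≢z (r ◅ w) with scan x≢z w
    ... | inj₁ found = inj₁ found
    ... | inj₂ (b≢x , w′) with a ≟A x
    ...   | yes refl = inj₁ (_ , r , w′)
    ...   | no a≢x = inj₂ (a≢x , (r , a≢x , b≢x) ◅ w′)
    go : ∀ {z} → x ≢ z → Star R x z → ∃ λ y → R x y × Star Off y z
    go x≢z w with scan x≢z w
    ... | inj₁ found = found
    ... | inj₂ (x≢x , _) = ⊥-elim (x≢x refl)

module _ (T : Graph) (tree : IsTree T) where

  private
    fin = proj₁ tree
    acyclic = proj₂ (proj₂ (proj₂ tree))
    _≟T_ : DecidableEquality (V T)
    _≟T_ = finite⇒≟ {T} fin

  module _ (next : V T → V T) (next-edge : ∀ x → E T x (next x))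
           (no-return : ∀ x → next (next x) ≢ x) where
    private
      iter : ℕ → V T → V T
      iter zero x = x
      iter (suc k) x = next (iter k x)

      iter-+ : ∀ a b x → iter (a + b) x ≡ iter a (iter b x)
      iter-+ zero b x = refl
      iter-+ (suc a) b x = cong next (iter-+ a b x)

      iter-∸ : ∀ {a b} x → a < b → iter a x ≡ iter b x →
               iter (suc (b ∸ suc a)) (iter a x) ≡ iter a x
      iter-∸ {a} {b} x a<b eq = trans (sym (iter-+ (suc (b ∸ suc a)) a x))
        (trans (cong (λ k → iter k x) (trans (sym (+-suc (b ∸ suc a) a)) (m∸n+n≡m a<b))) (sym eq))

      -- Strong induction on the period: if no point has a shorter period, the orbit of `x` is
      -- injective. Period one would be a loop, period two is `no-return`, and any longer orbit is a
      -- cycle of the tree.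
      no-period : ∀ d x → iter (suc d) x ≢ x
      no-period = <-rec _ λ d rec x eq → close d x eq (inj d rec x)
        where
        p : ∀ d → V T → Fin (suc d) → V T
        p d x i = iter (toℕ i) x
        shift : ∀ d → (∀ {k} → k < d → ∀ x → iter (suc k) x ≢ x) → ∀ x (i j : Fin (suc d)) →
                toℕ i < toℕ j → iter (toℕ i) x ≢ iter (toℕ j) x
        shift d rec x i j i<j eq = rec lt (iter (toℕ i) x) (iter-∸ x i<j eq)
          where
          lt : toℕ j ∸ suc (toℕ i) < d
          lt = ≤-trans (∸-monoʳ-< {o = 0} z<s i<j) (FP.toℕ≤pred[n] j)
        inj : ∀ d → (∀ {k} → k < d → ∀ x → iter (suc k) x ≢ x) → ∀ x → Injective _≡_ _≡_ (p d x)
        inj d rec x {i} {j} eq with <-cmp (toℕ i) (toℕ j)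
        ... | tri< i<j _ _ = ⊥-elim (shift d rec x i j i<j eq)
        ... | tri≈ _ i≡j _ = FP.toℕ-injective i≡j
        ... | tri> _ _ j<i = ⊥-elim (shift d rec x j i j<i (sym eq))
        close : ∀ d x → iter (suc d) x ≡ x → Injective _≡_ _≡_ (p d x) → ⊥
        close zero x eq _ = E-irr T (subst (E T x) eq (next-edge x))
        close (suc zero) x eq _ = no-return x eq
        close (suc (suc d)) x eq inj′ = acyclic (suc (suc d)) (p _ x) (s≤s (s≤s z≤n)) inj′
          (λ i → subst (λ k → E T (iter k x) (iter (suc (toℕ i)) x)) (sym (FP.toℕ-inject₁ i))
                   (next-edge (iter (toℕ i) x)))
          (subst (λ k → E T (iter k x) x) (sym (FP.toℕ-fromℕ (suc (suc d))))
            (subst (E T _) eq (next-edge _)))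

    no-escape : V T → ⊥
    no-escape x with FP.pigeonhole (n<1+n (proj₁ fin)) (λ i → Inverse.from (proj₂ fin) (iter (toℕ i) x))
    ... | i , j , i<j , eq = no-period (toℕ j ∸ suc (toℕ i)) _ (iter-∸ x i<j
      (trans (sym (Inverse.strictlyInverseˡ (proj₂ fin) _))
        (trans (cong (Inverse.to (proj₂ fin)) eq) (Inverse.strictlyInverseˡ (proj₂ fin) _))))

  -- Loop erasure leaves a simple path from `y` to `x`, which the edge closes to a cycle unless the
  -- path is the forbidden step itself. Forbidding one direction is enough, since a simple path from
  -- `y` never returns to `y`.
  bridge : ∀ x y → E T x y → ¬ Star (λ a b → E T a b × ¬ (a ≡ y × b ≡ x)) y x
  bridge x y e w with eraseLoops _≟T_ w
  ... | simplePath zero p s t inj edge = E-irr T (subst (E T x) (trans (sym s) t) e)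
  ... | simplePath (suc zero) p s t inj edge = proj₂ (edge F.zero) (s , t)
  ... | simplePath (suc (suc m)) p s t inj edge =
    acyclic (suc (suc m)) p (s≤s (s≤s z≤n)) inj (proj₁ ∘ edge) (subst₂ (E T) (sym t) (sym s) e)

  -- Helly property of subtrees: a node x missing from B i is oriented along the edge leaving x
  -- towards B i.  No edge is oriented both ways, so following the orientation closes a cycle.
  helly : {I : Set} (B : I → V T → Set) →
          (∀ i {x y} → B i x → B i y → Star (Within T (B i)) x y) →
          (∀ i j → ∃ λ x → B i x × B j x) →
          (∀ x → ∃ λ i → ¬ B i x) → ⊥
  helly B connected meet miss = no-escape next next-edge no-return (proj₁ (proj₂ tree))
    where
    goal : V T → V T
    goal x = proj₁ (meet (proj₁ (miss x)) (proj₁ (miss x)))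
    goal∈ : ∀ x → B (proj₁ (miss x)) (goal x)
    goal∈ x = proj₁ (proj₂ (meet (proj₁ (miss x)) (proj₁ (miss x))))
    x≢goal : ∀ x → x ≢ goal x
    x≢goal x eq = proj₂ (miss x) (subst (B _) (sym eq) (goal∈ x))
    depart : ∀ x → ∃ λ y → E T x y × Star (λ a b → E T a b × a ≢ x × b ≢ x) y (goal x)
    depart x = lastDeparture _≟T_ (Star.map proj₁ (walk⇒star {T} {λ _ → ⊤} (proj₁ (proj₂ (proj₂ tree)) x (goal x)))) (x≢goal x)
    next : V T → V T
    next x = proj₁ (depart x)
    next-edge : ∀ x → E T x (next x)
    next-edge x = proj₁ (proj₂ (depart x))
    no-return : ∀ x → next (next x) ≢ x
    -- If the orientation leads from `x` to `y` and back, a walk from `y` to `x` avoids the step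
    -- from `y` to `x`: before the common node `w` no step enters `x`, and after `w` no step leaves
    -- `y`.
    no-return x eq = bridge x y (next-edge x) (out ◅◅ across ◅◅ back)
      where
      y = next x
      Step : V T → V T → Set
      Step a b = E T a b × ¬ (a ≡ y × b ≡ x)
      w = proj₁ (meet (proj₁ (miss x)) (proj₁ (miss y)))
      w∈x = proj₁ (proj₂ (meet (proj₁ (miss x)) (proj₁ (miss y))))
      w∈y = proj₂ (proj₂ (meet (proj₁ (miss x)) (proj₁ (miss y))))
      out : Star Step y w
      out = Star.map (λ (e , _ , b≢x) → e , b≢x ∘ proj₂) (proj₂ (proj₂ (depart x)))
        ◅◅ Star.map (λ (e , _ , b∈) → e , λ (_ , b≡x) → proj₂ (miss x) (subst (B _) b≡x b∈))
             (connected _ (goal∈ x) w∈x)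
      across : Star Step w (goal y)
      across = Star.map (λ (e , a∈ , _) → e , λ (a≡y , _) → proj₂ (miss y) (subst (B _) a≡y a∈))
             (connected _ w∈y (goal∈ y))
      back : Star Step (goal y) x
      back = subst (Star Step (goal y)) eq
        (Star.reverse (λ (e , a≢y , b≢y) → E-sym T e , b≢y ∘ proj₁) (proj₂ (proj₂ (depart y))))

module _ {G : Graph} (D : TreeDecomposition G) where

  Meets : (V G → Set) → V (T D) → Set
  Meets P x = ∃ λ v → v ∈ bag D x × P v

  meets-connected : ∀ {P} {u v x y} → Star (Within G P) u v → P u →
    u ∈ bag D x → v ∈ bag D y → Star (Within (T D) (Meets P)) x y
  meets-connected {u = u} ε pu u∈x u∈y =
    Star.map (λ (e , a , b) → e , (u , a , pu) , (u , b , pu)) (walk⇒star {T D} {λ z → u ∈ bag D z} (conn D u _ _ u∈x u∈y))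
  meets-connected ((e , pu , pu′) ◅ w) _ u∈x v∈y with cover-e D _ _ e
  ... | z , u∈z , u′∈z = meets-connected ε pu u∈x u∈z ◅◅ meets-connected w pu′ u′∈z v∈y

  -- The bags met by a connected set form a subtree, and the bag covering an edge between two sets
  -- meets both. By `helly` some bag cannot miss any of the sets.
  bramble : {I : Set} (P : I → V G → Set) →
            (∀ i {u v} → P i u → P i v → Star (Within G (P i)) u v) →
            (∀ i j → ∃₂ λ u v → P i u × P j v × E G u v) →
            (∀ x → ∃ λ i → ∀ v → v ∈ bag D x → ¬ P i v) → ⊥
  bramble P connected touch miss = helly (T D) (T-tree D) (Meets ∘ P)
    (λ i (u , u∈ , pu) (v , v∈ , pv) → meets-connected (connected i pu pv) pu u∈ v∈)
    (λ i j → let (u , v , pu , pv , e) = touch i j ; (z , u∈ , v∈) = cover-e D u v e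
             in z , (u , u∈ , pu) , (v , v∈ , pv))
    (λ x → let (i , none) = miss x in i , λ (v , v∈ , pv) → none v v∈ pv)

unlabelled : ∀ {A : Set} (f : A → ℕ) n (xs : List A) → length xs < n →
             ∃ λ (i : Fin n) → ∀ a → a ∈ xs → f a ≢ toℕ i
unlabelled f n xs lt with FP.any? (λ i → FP.all? (λ k → ¬? (f (lookup xs k) ≟ toℕ {n} i)))
... | yes (i , all) = i , λ a a∈ eq → all (index a∈) (trans (cong f (sym (AnyP.lookup-index a∈))) eq)
... | no none = ⊥-elim (clash (FP.pigeonhole lt (proj₁ ∘ hit)))
  where
  hit : ∀ (i : Fin n) → ∃ λ k → f (lookup xs k) ≡ toℕ i
  hit i with FP.any? (λ k → f (lookup xs k) ≟ toℕ i)
  ... | yes h = h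
  ... | no ¬h = ⊥-elim (none (i , λ k eq → ¬h (k , eq)))
  clash : ¬ ∃₂ λ i j → i F.< j × proj₁ (hit i) ≡ proj₁ (hit j)
  clash (i , j , i<j , eq) = <⇒≢ i<j
    (trans (sym (proj₂ (hit i))) (trans (cong (f ∘ lookup xs) eq) (proj₂ (hit j))))

-- Arrays

injective⇒surjective : ∀ {n} (f : Fin n → Fin n) → Injective _≡_ _≡_ f → ∀ k → ∃ λ m → f m ≡ k
injective⇒surjective {suc n} f inj k with FP.any? (λ m → f m FP.≟ k)
... | yes hit = hit
... | no miss with FP.pigeonhole (n<1+n n) (λ m → F.punchOut {i = k} {j = f m} (λ eq → miss (m , sym eq)))
...   | i , j , i<j , eq = ⊥-elim (<⇒≢ i<j (cong toℕ (inj (FP.punchOut-injective {i = k} _ _ eq))))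

module Array (n L s : ℕ) (s≤1 : s ≤ 1) (2≤L : 2 ≤ L) where

  Vertex : Set
  Vertex = (Fin n × Fin (n * L)) ⊎ Fin n

  pattern cell i c = inj₁ (i , c)
  pattern hub j = inj₂ j

  Block : ℕ → ℕ → Set
  Block j c = j * L ≤ c × c ≤ j * L + s

  Adj : Vertex → Vertex → Set
  Adj (cell i c) (cell i′ c′) = i ≡ i′ × (suc (toℕ c) ≡ toℕ c′ ⊎ suc (toℕ c′) ≡ toℕ c)
  Adj (cell i c) (hub j) = Block (toℕ j) (toℕ c)
  Adj (hub j) (cell i c) = Block (toℕ j) (toℕ c)
  Adj (hub _) (hub _) = ⊥

  Adj-sym : ∀ {u v} → Adj u v → Adj v u
  Adj-sym {cell i c} {cell i′ c′} (refl , inj₁ e) = refl , inj₂ e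
  Adj-sym {cell i c} {cell i′ c′} (refl , inj₂ e) = refl , inj₁ e
  Adj-sym {cell i c} {hub j} b = b
  Adj-sym {hub j} {cell i c} b = b

  Adj-irr : ∀ {v} → ¬ Adj v v
  Adj-irr {cell i c} (_ , inj₁ e) = 1+n≢n e
  Adj-irr {cell i c} (_ , inj₂ e) = 1+n≢n e

  array : Graph
  array = record { V = Vertex ; E = Adj
                 ; E-sym = λ {u} {v} → Adj-sym {u} {v} ; E-irr = λ {v} → Adj-irr {v} }

  array-finite : Finite array
  array-finite = n * (n * L) + n , ((FP.*↔× {n} {n * L} ⊎-↔ ↔-id (Fin n)) ↔-∘ FP.+↔⊎ {n * (n * L)} {n})

  -- A hub is placed at the start of its block. As `s ≤ 1`, positions then change by at most one
  -- along every edge, and a hub lies in its own block.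
  pos : Vertex → ℕ
  pos (cell i c) = toℕ c
  pos (hub j) = toℕ j * L

  block-< : ∀ {a b} → a < b → a * L + s < b * L
  block-< {a} {b} a<b = begin-strict
    a * L + s <⟨ +-monoʳ-< (a * L) (≤-trans (s≤s s≤1) 2≤L) ⟩
    a * L + L ≡⟨ +-comm (a * L) L ⟩
    suc a * L ≤⟨ *-monoˡ-≤ L a<b ⟩
    b * L ∎
    where open ≤-Reasoning

  block-unique : ∀ {a b c} → Block a c → Block b c → a ≡ b
  block-unique {a} {b} (la , ua) (lb , ub) with <-cmp a b
  ... | tri< a<b _ _ = ⊥-elim (<-irrefl refl (≤-trans (s≤s ua) (≤-trans (block-< a<b) lb)))
  ... | tri≈ _ a≡b _ = a≡b
  ... | tri> _ _ b<a = ⊥-elim (<-irrefl refl (≤-trans (s≤s ub) (≤-trans (block-< b<a) la)))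

  hub-block : ∀ (j : Fin n) → Block (toℕ j) (pos (hub j))
  hub-block j = ≤-refl , m≤m+n _ _

  pos-step : ∀ {u v} → Adj u v → pos v ≤ suc (pos u)
  pos-step {cell i c} {cell i′ c′} (_ , inj₁ e) = ≤-reflexive (sym e)
  pos-step {cell i c} {cell i′ c′} (_ , inj₂ e) = ≤-trans (n≤1+n _) (≤-trans (≤-reflexive e) (n≤1+n _))
  pos-step {cell i c} {hub j} (l , u) = ≤-trans l (n≤1+n _)
  pos-step {hub j} {cell i c} (l , u) =
    ≤-trans u (≤-trans (+-monoʳ-≤ (toℕ j * L) s≤1) (≤-reflexive (+-comm _ 1)))

  -- This makes a block a cut: a row edge moves by one column, and the edges of a hub stay inside
  -- the block of that hub, so nothing leaps over block `j`.
  no-jump : ∀ {u v} j → Adj u v → pos u < j * L → ¬ j * L + s < pos v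
  no-jump {cell i c} {cell i′ c′} j e lo hi =
    <-irrefl refl (≤-trans hi (≤-trans (pos-step {cell i c} {cell i′ c′} e) (≤-trans lo (m≤m+n _ s))))
  no-jump {cell i c} {hub a} j (l , u) lo hi with <-cmp (toℕ a) j
  ... | tri< a<j _ _ = <-irrefl refl (≤-trans hi (≤-trans (*-monoˡ-≤ L (<⇒≤ a<j)) (m≤m+n _ s)))
  ... | tri≈ _ refl _ = <-irrefl refl (≤-trans lo l)
  ... | tri> _ _ j<a = <-irrefl refl (≤-trans lo (≤-trans (*-monoˡ-≤ L (<⇒≤ j<a)) l))
  no-jump {hub a} {cell i c} j (l , u) lo hi with <-cmp (toℕ a) j
  ... | tri< a<j _ _ = <-irrefl refl (≤-trans hi (≤-trans u (≤-trans (<⇒≤ (block-< a<j)) (m≤m+n _ s))))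
  ... | tri≈ _ refl _ = <-irrefl refl lo
  ... | tri> _ _ j<a = <-irrefl refl (≤-trans lo (*-monoˡ-≤ L (<⇒≤ j<a)))

  -- The index in `Fin 3` determines the neighbour, so degree bounds for cells become injections
  -- into `Fin 3`.
  data Nbr (i : Fin n) (c : Fin (n * L)) : Vertex → Fin 3 → Set where
    left  : ∀ {c′} → suc (toℕ c′) ≡ toℕ c → Nbr i c (cell i c′) F.zero
    right : ∀ {c′} → suc (toℕ c) ≡ toℕ c′ → Nbr i c (cell i c′) (F.suc F.zero)
    up    : ∀ {j} → Block (toℕ j) (toℕ c) → Nbr i c (hub j) (F.suc (F.suc F.zero))

  nbr : ∀ {i c v} → Adj (cell i c) v → ∃ (Nbr i c v)
  nbr {v = cell i c} (refl , inj₁ e) = _ , right e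
  nbr {v = cell i c} (refl , inj₂ e) = _ , left e
  nbr {v = hub j} b = _ , up b

  nbr-injective : ∀ {i c v v′ k} → Nbr i c v k → Nbr i c v′ k → v ≡ v′
  nbr-injective (left e) (left e′) = cong (cell _) (FP.toℕ-injective (suc-injective (trans e (sym e′))))
  nbr-injective (right e) (right e′) = cong (cell _) (FP.toℕ-injective (trans (sym e) e′))
  nbr-injective (up b) (up b′) = cong hub (FP.toℕ-injective (block-unique b b′))

  nbr-kinds : ∀ {d i c} (a : Fin d → Vertex) → Injective _≡_ _≡_ a → (∀ m → Adj (cell i c) (a m)) →
              Σ (Fin d → Fin 3) λ kind → Injective _≡_ _≡_ kind × ∀ m → Nbr i c (a m) (kind m)
  nbr-kinds {i = i} {c} a inj adj = proj₁ ∘ kinds ,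
    (λ {m} {m′} eq → inj (nbr-injective (subst (Nbr i c (a m)) eq (proj₂ (kinds m))) (proj₂ (kinds m′)))) ,
    proj₂ ∘ kinds
    where
    kinds : ∀ m → ∃ (Nbr i c (a m))
    kinds m = nbr {v = a m} (adj m)

  cell-degree : ∀ {d i c} (a : Fin d → Vertex) → Injective _≡_ _≡_ a → (∀ m → Adj (cell i c) (a m)) → d ≤ 3
  cell-degree a inj adj = FP.injective⇒≤ (proj₁ (proj₂ (nbr-kinds a inj adj)))

  cell-nbrs : ∀ {i c} (a : Fin 3 → Vertex) → Injective _≡_ _≡_ a → (∀ m → Adj (cell i c) (a m)) →
              ∀ k → ∃ λ m → Nbr i c (a m) k
  cell-nbrs {i} {c} a inj adj k =
    let (kind , kind-inj , is-nbr) = nbr-kinds a inj adj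
        (m , eq) = injective⇒surjective kind kind-inj k
    in m , subst (Nbr i c (a m)) eq (is-nbr m)

  -- Three neighbours of a cell must be its left and right cells and its hub. If the cell is not the
  -- first of the block, the left cell is also in the block; if it is the first, the right cell is,
  -- because `1 ≤ s`.
  adjacent-nbrs : 1 ≤ s → ∀ {i c} (a : Fin 3 → Vertex) → Injective _≡_ _≡_ a →
                  (∀ m → Adj (cell i c) (a m)) → ∃₂ λ m m′ → Adj (a m) (a m′)
  adjacent-nbrs 1≤s {i} {c} a inj adj
    with cell-nbrs a inj adj F.zero | cell-nbrs a inj adj (F.suc F.zero) | cell-nbrs a inj adj (F.suc (F.suc F.zero))
  ... | m₀ , l | m₁ , r | m₂ , h = pick (a m₀) (a m₁) (a m₂) refl refl refl l r h
    where
    pick : ∀ x y z → x ≡ a m₀ → y ≡ a m₁ → z ≡ a m₂ →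
           Nbr i c x F.zero → Nbr i c y (F.suc F.zero) → Nbr i c z (F.suc (F.suc F.zero)) →
           ∃₂ λ m m′ → Adj (a m) (a m′)
    pick _ _ _ ex ey ez (left {c₀} e) (right {c₁} e′) (up {j} (lo , hi)) with m≤n⇒m<n∨m≡n lo
    ... | inj₁ lt = m₂ , m₀ , subst₂ Adj ez ex
          (≤-pred (≤-trans lt (≤-reflexive (sym e))) , ≤-trans (n≤1+n _) (≤-trans (≤-reflexive e) hi))
    ... | inj₂ eq = m₂ , m₁ , subst₂ Adj ez ey
          ( ≤-trans lo (≤-trans (n≤1+n _) (≤-reflexive e′))
          , ≤-trans (≤-reflexive (trans (sym e′) (cong suc (sym eq))))
              (≤-trans (≤-reflexive (+-comm 1 (toℕ j * L))) (+-monoʳ-≤ (toℕ j * L) 1≤s)))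

  -- Three steps of size one along a row cannot close up, by parity, so some vertex is a hub; its
  -- block contains the cells adjacent to it.
  triangle-hub : ∀ x y z → Adj x y → Adj y z → Adj z x →
    ∃ λ j → Block (toℕ j) (pos x) × (hub j ≡ x ⊎ hub j ≡ y ⊎ hub j ≡ z)
  triangle-hub (hub j) y z _ _ _ = j , hub-block j , inj₁ refl
  triangle-hub (cell i c) (hub j) z b _ _ = j , b , inj₂ (inj₁ refl)
  triangle-hub (cell i c) (cell i′ c′) (hub j) _ _ b = j , b , inj₂ (inj₂ refl)
  triangle-hub (cell i c) (cell _ c′) (cell _ c″) (_ , xy) (_ , yz) (_ , zx) = ⊥-elim (odd xy yz zx)
    where
    odd : ∀ {a b c} → suc a ≡ b ⊎ suc b ≡ a → suc b ≡ c ⊎ suc c ≡ b → suc c ≡ a ⊎ suc a ≡ c → ⊥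
    odd (inj₁ refl) (inj₁ refl) (inj₁ ())
    odd (inj₁ refl) (inj₁ refl) (inj₂ ())
    odd (inj₁ refl) (inj₂ refl) (inj₁ ())
    odd (inj₁ refl) (inj₂ refl) (inj₂ ())
    odd (inj₂ refl) (inj₁ refl) (inj₁ ())
    odd (inj₂ refl) (inj₁ refl) (inj₂ ())
    odd (inj₂ refl) (inj₂ refl) (inj₁ ())
    odd (inj₂ refl) (inj₂ refl) (inj₂ ())

  fork-hub : ∀ x (a : Fin 3 → Vertex) → Injective _≡_ _≡_ a → (∀ m → Adj x (a m)) →
    ∃ λ j → Block (toℕ j) (pos x) × (hub j ≡ x ⊎ ∃ λ m → hub j ≡ a m)
  fork-hub (hub j) a inj adj = j , hub-block j , inj₁ refl
  fork-hub (cell i c) a inj adj with cell-nbrs a inj adj (F.suc (F.suc F.zero))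
  ... | m , nb = go (a m) refl nb
    where
    go : ∀ x → x ≡ a m → Nbr i c x (F.suc (F.suc F.zero)) →
         ∃ λ j → Block (toℕ j) (toℕ c) × (hub j ≡ cell i c ⊎ ∃ λ m → hub j ≡ a m)
    go (hub j) eq (up b) = j , b , inj₂ (m , eq)

  hub≢⇒far : ∀ {j j′ : Fin n} → j ≢ j′ → pos (hub j) ≤ pos (hub j′) → pos (hub j) + L ≤ pos (hub j′)
  hub≢⇒far {j} {j′} j≢j′ le with <-cmp (toℕ j) (toℕ j′)
  ... | tri< j<j′ _ _ = ≤-trans (≤-reflexive (+-comm (toℕ j * L) L)) (*-monoˡ-≤ L j<j′)
  ... | tri≈ _ eq _ = ⊥-elim (j≢j′ (FP.toℕ-injective eq))
  ... | tri> _ _ j′<j = ⊥-elim (<-irrefl refl (≤-trans (s≤s le) (≤-trans (s≤s (m≤m+n _ s)) (block-< j′<j))))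

  foot : ∀ (j : Fin n) → Fin (n * L)
  foot j = fromℕ< {toℕ j * L} (≤-trans (s≤s (m≤m+n _ s)) (block-< (FP.toℕ<n j)))

  foot-block : ∀ j → Block (toℕ j) (toℕ (foot j))
  foot-block j = subst (Block (toℕ j)) (sym (FP.toℕ-fromℕ< _)) (hub-block j)

  Cross : Fin n × Fin n → Vertex → Set
  Cross (i , j) (cell i′ _) = i′ ≡ i
  Cross (i , j) (hub j′) = j′ ≡ j

  cross-connected : ∀ k {u v} → Cross k u → Cross k v → Star (Within array (Cross k)) u v
  cross-connected (i , j) {u} {v} pu pv =
    to-hub u pu ◅◅ Star.reverse (λ {x} {y} → Within-sym array {Cross (i , j)} {x} {y}) (to-hub v pv)
    where
    Step = Within array (Cross (i , j))
    along : ∀ a {b} (a< : a < n * L) (b< : b < n * L) → a ≤ b → Star Step (cell i (fromℕ< a<)) (cell i (fromℕ< b<))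
    along a {b} a< b< a≤b with m≤n⇒m<n∨m≡n a≤b
    ... | inj₂ refl = subst (λ q → Star Step (cell i (fromℕ< a<)) (cell i q)) (FP.fromℕ<-cong a a refl a< b<) ε
    along a {suc b} a< b< a≤b | inj₁ (s≤s a≤b′) =
      along a a< (<-trans (n<1+n b) b<) a≤b′ ◅◅
      (((refl , inj₁ (trans (cong suc (FP.toℕ-fromℕ< _)) (sym (FP.toℕ-fromℕ< b<)))) , refl , refl) ◅ ε)
    row : ∀ c c′ → Star Step (cell i c) (cell i c′)
    row c c′ = subst₂ (λ p q → Star Step (cell i p) (cell i q)) (FP.fromℕ<-toℕ c _) (FP.fromℕ<-toℕ c′ _) go
      where
      go : Star Step (cell i (fromℕ< (FP.toℕ<n c))) (cell i (fromℕ< (FP.toℕ<n c′)))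
      go with ≤-total (toℕ c) (toℕ c′)
      ... | inj₁ le = along _ (FP.toℕ<n c) (FP.toℕ<n c′) le
      ... | inj₂ ge = Star.reverse (λ {x} {y} → Within-sym array {Cross (i , j)} {x} {y}) (along _ (FP.toℕ<n c′) (FP.toℕ<n c) ge)
    to-hub : ∀ u → Cross (i , j) u → Star Step u (hub j)
    to-hub (cell _ c) refl = row c (foot j) ◅◅ ((foot-block j , refl , refl) ◅ ε)
    to-hub (hub _) refl = ε

  -- A bag has at most `suc w` vertices, fewer than `n`, so it avoids all cells of some row and also
  -- some hub, and with them a whole cross.
  array-treewidth : ∀ w → suc w < n → ¬ TreewidthAtMost array w
  array-treewidth w lt (D , small) = bramble D Cross cross-connected
    (λ (i , j) (i′ , j′) → cell i (foot j′) , hub j′ , refl , refl , foot-block j′)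
    λ x → let short = ≤-trans (s≤s (small x)) lt
              (i , no-i) = unlabelled rowOf n (bag D x) short
              (j , no-j) = unlabelled hubOf n (bag D x) short
          in (i , j) , λ { (cell _ _) v∈ refl → no-i _ v∈ refl ; (hub _) v∈ refl → no-j _ v∈ refl }
    where
    -- n is a junk label.
    rowOf hubOf : Vertex → ℕ
    rowOf (cell i _) = toℕ i
    rowOf (hub _) = n
    hubOf (cell _ _) = n
    hubOf (hub j) = toℕ j

  -- Hubs are pairwise nonadjacent, so each edge has an end that is a cell, of degree at most three.
  -- This excludes large complete and complete bipartite subgraphs alike.
  no-big-edge : ∀ {x y} → Adj x y → (a b : Fin 4 → Vertex) → Injective _≡_ _≡_ a → Injective _≡_ _≡_ b →
                (∀ m → Adj x (a m)) → (∀ m → Adj y (b m)) → ⊥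
  no-big-edge {cell i c} _ a b ia ib xa yb = <-irrefl refl (cell-degree a ia xa)
  no-big-edge {hub j} {cell i c} _ a b ia ib xa yb = <-irrefl refl (cell-degree b ib yb)

-- Grid models and their cuts

¬¬-Π : ∀ {k} {P : Fin k → Set} → (∀ i → ¬ ¬ P i) → ¬ ¬ (∀ i → P i)
¬¬-Π {zero} _ none = none λ ()
¬¬-Π {suc k} dn none = dn F.zero λ p₀ → ¬¬-Π (dn ∘ F.suc) λ ps →
  none λ { F.zero → p₀ ; (F.suc i) → ps i }

¬Π⇒¬¬Σ¬ : ∀ {k} {P : Fin k → Set} → ¬ (∀ i → P i) → ¬ ¬ ∃ λ i → ¬ P i
¬Π⇒¬¬Σ¬ none noΣ = ¬¬-Π (λ i ¬p → noΣ (i , ¬p)) none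

module _ (G : Graph) (Good : V G → Set) where

  Fork : V G → Set
  Fork v = Σ (Fin 3 → V G) λ a → Injective _≡_ _≡_ a × (∀ m → Good (a m) × E G v (a m))

  Triangle : V G → Set
  Triangle v = ∃₂ λ y z → Good y × Good z × E G v y × E G y z × E G z v

-- Distinct good neighbours use distinct ports, so good vertices have at most d good neighbours.
-- Equality in a subdivided wall is not decidable, whence the double negations.
record GridModel (k d : ℕ) (G : Graph) : Set₁ where
  field
    Good           : V G → Set
    Port           : V G → V G → Fin d → Set
    port           : ∀ {v a} → Good v → Good a → E G v a → ∃ (Port v a)
    port-injective : ∀ {v a b p} → Good v → Good a → Good b → E G v a → E G v b →
                     Port v a p → Port v b p → a ≡ b
    Line           : Bool → Fin k → V G → Set
    line-good      : ∀ {δ i v} → Line δ i v → Good v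
    -- Two labels per direction: a vertex of a line graph is an edge, and its two ends may lie on
    -- different lines.
    label          : Bool → V G → Fin 2 → ℕ
    line-label     : ∀ {δ i v} → Line δ i v → ∃ λ q → label δ v q ≡ toℕ i
    line-connected : ∀ δ i {u v} → Line δ i u → Line δ i v → ¬ ¬ Star (Within G (Line δ i)) u v
    crossing       : ∀ i j → ¬ ¬ ∃ λ v → Line false i v × Line true j v ×
                     (Fork G Good v ⊎ Triangle G Good v)

module _ (n L s : ℕ) (s≤1 : s ≤ 1) (2≤L : 2 ≤ L) where
  open Array n L s s≤1 2≤L

  module _ {k d G} (model : GridModel (suc k) d G) (k≥ : suc d * 2 ≤ k) (emb : Embeds G array) where
    open GridModel model

    private
      f = proj₁ emb
      f-inj = proj₁ (proj₂ emb)

      push : ∀ {u v} → E G u v → Adj (f u) (f v)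
      push = Equivalence.to (proj₂ (proj₂ emb) _ _)

      Active : Fin n → Set
      Active j = ∃ λ u → Good u × f u ≡ hub j

      Cut : Fin n → V G → Set
      Cut j u = Block (toℕ j) (pos (f u))

      branch-active : ∀ {v} → Good v → Fork G Good v ⊎ Triangle G Good v → ∃ λ j → Active j × Cut j v
      branch-active {v} gv (inj₁ (a , inj , nbrs))
        with fork-hub (f v) (f ∘ a) (inj ∘ f-inj) (push ∘ proj₂ ∘ nbrs)
      ... | j , b , inj₁ eq = j , (v , gv , sym eq) , b
      ... | j , b , inj₂ (m , eq) = j , (a m , proj₁ (nbrs m) , sym eq) , b
      branch-active {v} gv (inj₂ (y , z , gy , gz , vy , yz , zv))
        with triangle-hub (f v) (f y) (f z) (push vy) (push yz) (push zv)
      ... | j , b , inj₁ eq = j , (v , gv , sym eq) , b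
      ... | j , b , inj₂ (inj₁ eq) = j , (y , gy , sym eq) , b
      ... | j , b , inj₂ (inj₂ eq) = j , (z , gz , sym eq) , b

      -- Here the embedding has to be induced: a cell of the block is adjacent to the hub in the
      -- array, hence its preimage is adjacent to `x` in `G`.
      cut-star : ∀ {j x u} → f x ≡ hub j → Cut j u → u ≡ x ⊎ E G x u
      cut-star {j} {x} {u} fx b = go (f u) refl b
        where
        go : ∀ y → f u ≡ y → Block (toℕ j) (pos y) → u ≡ x ⊎ E G x u
        go (cell i c) eq b = inj₂ (Equivalence.from (proj₂ (proj₂ emb) x u)
          (subst₂ Adj (sym fx) (sym eq) b))
        go (hub j′) eq b = inj₁ (f-inj (trans eq (trans
          (cong inj₂ (FP.toℕ-injective (block-unique (hub-block j′) b))) (sym fx))))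

      -- An active cut consists of a hub x and neighbours of x, so it has at most 1 + d good vertices.
      cut-misses : ∀ δ {j} → Active j → ¬ (∀ i → ∃ λ u → Line δ i u × Cut j u)
      cut-misses δ {j} (x , gx , fx) hits =
        -- There are `suc k` lines but only `suc d * 2` pairs of a vertex code and a label slot.
        -- Equal pairs give the same vertex and the same label, hence the same line.
        clash (FP.pigeonhole (s≤s k≥) λ i → F.combine (code i) (proj₁ (lab i)))
        where
        u : Fin (suc k) → V G
        u i = proj₁ (hits i)
        near : ∀ i → u i ≡ x ⊎ E G x (u i)
        near i = cut-star fx (proj₂ (proj₂ (hits i)))
        good : ∀ i → Good (u i)
        good i = line-good (proj₁ (proj₂ (hits i)))
        lab : ∀ i → ∃ λ q → label δ (u i) q ≡ toℕ i
        lab i = line-label (proj₁ (proj₂ (hits i)))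
        encode : ∀ {w} → Good w → w ≡ x ⊎ E G x w → Fin (suc d)
        encode _ (inj₁ _) = F.zero
        encode gw (inj₂ e) = F.suc (proj₁ (port gx gw e))
        code : Fin (suc k) → Fin (suc d)
        code i = encode (good i) (near i)
        encode-injective : ∀ {v w} (gv : Good v) (gw : Good w) (p : v ≡ x ⊎ E G x v) (q : w ≡ x ⊎ E G x w) →
                           encode gv p ≡ encode gw q → v ≡ w
        encode-injective _ _ (inj₁ p) (inj₁ q) _ = trans p (sym q)
        encode-injective {v} gv gw (inj₂ p) (inj₂ q) eq = port-injective gx gv gw p q
          (subst (Port x v) (FP.suc-injective eq) (proj₂ (port gx gv p))) (proj₂ (port gx gw q))
        clash : ¬ ∃₂ λ i i′ → i F.< i′ ×
                F.combine (code i) (proj₁ (lab i)) ≡ F.combine (code i′) (proj₁ (lab i′))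
        clash (i , i′ , i<i′ , eq) with FP.combine-injective (code i) _ (code i′) _ eq
        ... | same-code , same-label = <⇒≢ i<i′ (trans (sym (proj₂ (lab i)))
                (trans (cong₂ (label δ) (encode-injective (good i) (good i′) (near i) (near i′) same-code) same-label)
                  (proj₂ (lab i′))))

      GridCross : Fin (suc k) × Fin (suc k) → V G → Set
      GridCross (i , i′) v = Line false i v ⊎ Line true i′ v

      grid-cross-connected : ∀ κ {u v} → GridCross κ u → GridCross κ v →
                             ¬ ¬ Star (Within G (GridCross κ)) u v
      grid-cross-connected κ@(i , i′) pu pv none =
        crossing i i′ λ (w , row , col , _) →
        to-centre row col pu λ walk → to-centre row col pv λ walk′ →
        none (walk ◅◅ Star.reverse (Within-sym G {GridCross κ}) walk′)
        where
        to-centre : ∀ {u w} → Line false i w → Line true i′ w → GridCross κ u →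
                    ¬ ¬ Star (Within G (GridCross κ)) u w
        to-centre row col (inj₁ p) none = line-connected false i p row
          (none ∘ Star.map (λ (e , a , b) → e , inj₁ a , inj₁ b))
        to-centre row col (inj₂ p) none = line-connected true i′ p col
          (none ∘ Star.map (λ (e , a , b) → e , inj₂ a , inj₂ b))

      Hits : Fin (suc k) × Fin (suc k) → Fin n → Set
      Hits κ j = ∃ λ u → GridCross κ u × Cut j u

      -- The row of one cross meets the column of the other in a branch vertex, and `branch-active`
      -- puts that vertex into an active cut.
      hits-meet : ∀ κ κ′ → ¬ ¬ ∃ λ j → Active j × Hits κ j × Hits κ′ j
      hits-meet (i , _) (_ , i′) none = crossing i i′ λ (v , row , col , br) →
        let (j , act , b) = branch-active (line-good row) br
        in none (j , act , (v , inj₁ row , b) , (v , inj₂ col , b))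

      hits-miss : ∀ {j} → Active j → ¬ ¬ ∃ λ κ → ¬ Hits κ j
      hits-miss act none =
        ¬Π⇒¬¬Σ¬ (cut-misses false act) λ (i , no-i) →
        ¬Π⇒¬¬Σ¬ (cut-misses true act) λ (i′ , no-i′) →
        none ((i , i′) , λ { (u , inj₁ p , b) → no-i (u , p , b) ; (u , inj₂ p , b) → no-i′ (u , p , b) })

      -- A walk inside the cross from block `a` to block `c` must enter block `b`, by `no-jump`. So
      -- the cuts hit by a cross form an interval.
      hits-convex : ∀ κ {a b c} → toℕ a < toℕ b → toℕ b < toℕ c → Hits κ a → Hits κ c → ¬ ¬ Hits κ b
      hits-convex κ {a} {b} {c} a<b b<c (u , pu , _ , u≤) (w , pw , w≥ , _) none =
        grid-cross-connected κ pu pw λ walk → none (scan walk (≤-trans (s≤s u≤) (block-< a<b)))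
        where
        w> : toℕ b * L + s < pos (f w)
        w> = ≤-trans (block-< b<c) w≥
        scan : ∀ {u} → Star (Within G (GridCross κ)) u w → pos (f u) < toℕ b * L → Hits κ b
        scan ε lo = ⊥-elim (<-irrefl refl (≤-trans lo (≤-trans (m≤m+n _ s) (<⇒≤ w>))))
        scan {u} (_◅_ {j = v} (e , _ , pv) rest) lo with pos (f v) <? toℕ b * L
        ... | yes v< = scan rest v<
        ... | no v≮ with pos (f v) ≤? toℕ b * L + s
        ...   | yes v≤ = v , pv , ≮⇒≥ v≮ , v≤
        ...   | no v≰ = ⊥-elim (no-jump {f u} {f v} (toℕ b) (push e) lo (≰⇒> v≰))

      -- The Helly property of intervals as a shrinking window: `κ` hits nothing before `lo`, `κ′`
      -- nothing from `hi` on, so a cut `j` hit by both lies between. A cross that misses `j` is by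
      -- convexity entirely on one side of it and replaces `κ` or `κ′`, making the window smaller.
      search : ∀ fuel {lo hi κ κ′} → hi ≤ lo + fuel →
               (∀ j → Hits κ j → lo ≤ toℕ j) → (∀ j → Hits κ′ j → toℕ j < hi) → ⊥
      search zero {lo} {κ = κ} {κ′} hi≤ above below = hits-meet κ κ′ λ (j , _ , h , h′) →
        <-irrefl refl (≤-trans (below j h′) (≤-trans hi≤ (≤-trans (≤-reflexive (+-identityʳ lo)) (above j h))))
      search (suc fuel) {lo} {hi} {κ} {κ′} hi≤ above below =
        hits-meet κ κ′ λ (j , act , h , h′) →
        hits-miss act λ (κ″ , miss) →
        hits-meet κ″ κ″ λ (e , _ , he , _) → narrow j h h′ miss e he
        where
        narrow : ∀ j → Hits κ j → Hits κ′ j → ∀ {κ″} → ¬ Hits κ″ j → ∀ e → Hits κ″ e → ⊥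
        narrow j h h′ {κ″} miss e he with <-cmp (toℕ e) (toℕ j)
        ... | tri≈ _ eq _ = miss (subst (Hits κ″) (FP.toℕ-injective eq) he)
        ... | tri< e<j _ _ = search fuel
              (≤-pred (≤-trans (below j h′) (≤-trans hi≤ (≤-reflexive (+-suc lo fuel))))) above left-of
              where
              left-of : ∀ i → Hits κ″ i → toℕ i < toℕ j
              left-of i hit with <-cmp (toℕ i) (toℕ j)
              ... | tri< lt _ _ = lt
              ... | tri≈ _ eq _ = ⊥-elim (miss (subst (Hits κ″) (FP.toℕ-injective eq) hit))
              ... | tri> _ _ gt = ⊥-elim (hits-convex κ″ e<j gt he hit miss)
        ... | tri> _ _ j<e = search fuel
              (≤-trans hi≤ (≤-trans (≤-reflexive (+-suc lo fuel)) (s≤s (+-monoˡ-≤ fuel (above j h))))) right-of below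
              where
              right-of : ∀ i → Hits κ″ i → toℕ j < toℕ i
              right-of i hit with <-cmp (toℕ i) (toℕ j)
              ... | tri< lt _ _ = ⊥-elim (hits-convex κ″ lt j<e hit he miss)
              ... | tri≈ _ eq _ = ⊥-elim (miss (subst (Hits κ″) (FP.toℕ-injective eq) hit))
              ... | tri> _ _ gt = gt

    no-grid-model : ⊥
    no-grid-model = search n {0} {n} {F.zero , F.zero} {F.zero , F.zero} ≤-refl
      (λ _ _ → z≤n) (λ j _ → FP.toℕ<n j)

-- Subdivisions and line graphs

module _ {G : Graph} (Good : V G → Set) (lab : Bool → V G → ℕ) where

  -- Row 0 and column 0 of the wall may contain deleted corners, so line i has label i + 1.
  OnLine : Bool → ℕ → V G → Set
  OnLine δ i v = Good v × lab δ v ≡ suc i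

-- These are facts that survive the subdivision of one edge, so they pass to all subdivisions by
-- induction. Forks are doubly negated because it cannot be decided whether a prong is the
-- subdivided edge.
record WallModel (k : ℕ) (S : Graph) : Set₁ where
  field
    Good           : V S → Set
    Port           : V S → V S → Fin 3 → Set
    port           : ∀ {v a} → Good v → Good a → E S v a → ∃ (Port v a)
    port-injective : ∀ {v a b p} → Good v → Good a → Good b → E S v a → E S v b →
                     Port v a p → Port v b p → a ≡ b
    lab            : Bool → V S → ℕ
    connected      : ∀ δ (i : Fin k) {u v} → OnLine {S} Good lab δ (toℕ i) u → OnLine {S} Good lab δ (toℕ i) v →
                     ¬ ¬ Star (Within S (OnLine {S} Good lab δ (toℕ i))) u v
    crossing       : ∀ (i j : Fin k) → ∃ λ v → OnLine {S} Good lab false (toℕ i) v ×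
                     OnLine {S} Good lab true (toℕ j) v × ¬ ¬ Fork S Good v

¬¬-concat : ∀ {A B : Set} {R : A → A → Set} {Q : B → B → Set} (g : A → B) →
            (∀ {x y} → R x y → ¬ ¬ Star Q (g x) (g y)) → ∀ {x y} → Star R x y → ¬ ¬ Star Q (g x) (g y)
¬¬-concat g one ε none = none ε
¬¬-concat g one (r ◅ w) none = one r λ q → ¬¬-concat g one w λ qs → none (q ◅◅ qs)

module _ {k S} (model : WallModel k S) (u v : V S) (e : E S u v) where
  open WallModel model

  private
    S′ = subdivideEdge S u v e

    Good′ : V S′ → Set
    Good′ (just a) = Good a
    Good′ nothing = Good u × Good v

    -- At `u` and at `v` the new vertex inherits the port of the subdivided edge; its own two
    -- neighbours get ports zero and one.
    Port′ : V S′ → V S′ → Fin 3 → Set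
    Port′ (just w) (just b) p = Port w b p
    Port′ (just w) nothing p = (w ≡ u × Port u v p) ⊎ (w ≡ v × Port v u p)
    Port′ nothing (just a) p = (a ≡ u × p ≡ F.zero) ⊎ (a ≡ v × p ≡ F.suc F.zero)
    Port′ nothing nothing p = ⊥

    port′ : ∀ {x y} → Good′ x → Good′ y → E S′ x y → ∃ (Port′ x y)
    port′ {just w} {just b} gw gb (wb , _) = port gw gb wb
    port′ {just w} {nothing} gw (gu , gv) (inj₁ w≡u) = map₂ (λ q → inj₁ (w≡u , q)) (port gu gv e)
    port′ {just w} {nothing} gw (gu , gv) (inj₂ w≡v) = map₂ (λ q → inj₂ (w≡v , q)) (port gv gu (E-sym S e))
    port′ {nothing} {just a} _ _ (inj₁ a≡u) = _ , inj₁ (a≡u , refl)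
    port′ {nothing} {just a} _ _ (inj₂ a≡v) = _ , inj₂ (a≡v , refl)

    -- A surviving edge that used the port inherited by the new vertex would be the subdivided edge
    -- itself.
    port-clash : ∀ {w b p} → Good w → Good b → Good u × Good v → E S′ (just w) (just b) →
                 Port w b p → ¬ Port′ (just w) nothing p
    port-clash gw gb (gu , gv) (wb , ends) q (inj₁ (refl , q′)) =
      ends (inj₁ (refl , port-injective gu gb gv wb e q q′))
    port-clash gw gb (gu , gv) (wb , ends) q (inj₂ (refl , q′)) =
      ends (inj₂ (refl , port-injective gv gb gu wb (E-sym S e) q q′))

    port-injective′ : ∀ {x y z p} → Good′ x → Good′ y → Good′ z → E S′ x y → E S′ x z →
                      Port′ x y p → Port′ x z p → y ≡ z
    port-injective′ {just w} {just a} {just b} gw ga gb wa wb q q′ =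
      cong just (port-injective gw ga gb (proj₁ wa) (proj₁ wb) q q′)
    port-injective′ {just w} {just a} {nothing} gw ga guv wa _ q q′ = ⊥-elim (port-clash gw ga guv wa q q′)
    port-injective′ {just w} {nothing} {just b} gw guv gb _ wb q q′ = ⊥-elim (port-clash gw gb guv wb q′ q)
    port-injective′ {just w} {nothing} {nothing} _ _ _ _ _ _ _ = refl
    port-injective′ {nothing} {just a} {just b} _ _ _ _ _ (inj₁ (refl , _)) (inj₁ (refl , _)) = refl
    port-injective′ {nothing} {just a} {just b} _ _ _ _ _ (inj₁ (_ , refl)) (inj₂ (_ , ()))
    port-injective′ {nothing} {just a} {just b} _ _ _ _ _ (inj₂ (_ , refl)) (inj₁ (_ , ()))
    port-injective′ {nothing} {just a} {just b} _ _ _ _ _ (inj₂ (refl , _)) (inj₂ (refl , _)) = refl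

    -- The new vertex is merged into u: it joins every line through u.
    retract : V S′ → V S
    retract (just a) = a
    retract nothing = u

    lab′ : Bool → V S′ → ℕ
    lab′ δ = lab δ ∘ retract

    module _ (δ : Bool) (i : Fin k) where
      On = OnLine {S} Good lab δ (toℕ i)
      On′ = OnLine {S′} Good′ lab′ δ (toℕ i)

      retract-on : ∀ {x} → On′ x → On (retract x)
      retract-on {just a} on = on
      retract-on {nothing} ((gu , _) , eq) = gu , eq

      to-retract : ∀ {x} → On′ x → Star (Within S′ On′) x (just (retract x))
      to-retract {just a} on = ε
      to-retract {nothing} on = (inj₁ refl , on , retract-on {nothing} on) ◅ ε

      -- A step along the subdivided edge becomes a detour through the new vertex, which has the
      -- label of `u` and hence lies on the same line.
      lift-step : ∀ {a b} → Within S On a b → ¬ ¬ Star (Within S′ On′) (just a) (just b)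
      lift-step {a} {b} (ab , oa , ob) none = ¬¬-excluded-middle {A = SameEdge (a , b) (u , v)} λ where
        (no differ) → none (((ab , differ) , oa , ob) ◅ ε)
        (yes (inj₁ (refl , refl))) →
          let mid = (proj₁ oa , proj₁ ob) , proj₂ oa
          in none (_◅_ {j = nothing} (inj₁ refl , oa , mid) ((inj₂ refl , mid , ob) ◅ ε))
        (yes (inj₂ (refl , refl))) →
          let mid = (proj₁ ob , proj₁ oa) , proj₂ ob
          in none (_◅_ {j = nothing} (inj₂ refl , oa , mid) ((inj₁ refl , mid , ob) ◅ ε))

    connected′ : ∀ δ (i : Fin k) {x y} → OnLine {S′} Good′ lab′ δ (toℕ i) x → OnLine {S′} Good′ lab′ δ (toℕ i) y →
                 ¬ ¬ Star (Within S′ (OnLine {S′} Good′ lab′ δ (toℕ i))) x y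
    connected′ δ i {x} {y} ox oy none =
      connected δ i (retract-on δ i {x} ox) (retract-on δ i {y} oy) λ w →
      ¬¬-concat just (lift-step δ i) w λ w′ →
      none (to-retract δ i ox ◅◅ w′ ◅◅
            Star.reverse (λ {x} {y} → Within-sym S′ {On′ δ i} {x} {y}) (to-retract δ i oy))

    -- A prong along the subdivided edge now ends at the new vertex. At most one prong changes,
    -- because `w` and that edge determine its leaf, so the leaves stay distinct.
    fork′ : ∀ {w} → Good w → Fork S Good w → ¬ ¬ Fork S′ Good′ (just w)
    fork′ {w} gw (a , inj , nbrs) none =
      ¬¬-Π {P = λ m → Dec (SameEdge (w , a m) (u , v))} (λ m → ¬¬-excluded-middle) λ same? →
      none ((λ m → move (a m) (same? m)) , (λ {m} {m′} eq → inj (move-injective (same? m) (same? m′) eq)) ,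
            λ m → move-nbr (proj₁ (nbrs m)) (proj₂ (nbrs m)) (same? m))
      where
      move : ∀ b → Dec (SameEdge (w , b) (u , v)) → V S′
      move b (yes _) = nothing
      move b (no _) = just b
      move-injective : ∀ {b c} (p : Dec (SameEdge (w , b) (u , v))) (q : Dec (SameEdge (w , c) (u , v))) →
                       move b p ≡ move c q → b ≡ c
      move-injective (no _) (no _) eq = just-injective eq
      move-injective (yes (inj₁ (_ , refl))) (yes (inj₁ (_ , refl))) _ = refl
      move-injective (yes (inj₁ (refl , refl))) (yes (inj₂ (u≡v , _))) _ = ⊥-elim (E-irr S (subst (E S u) (sym u≡v) e))
      move-injective (yes (inj₂ (refl , refl))) (yes (inj₁ (v≡u , _))) _ = ⊥-elim (E-irr S (subst (E S u) v≡u e))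
      move-injective (yes (inj₂ (_ , refl))) (yes (inj₂ (_ , refl))) _ = refl
      move-nbr : ∀ {b} → Good b → E S w b → (p : Dec (SameEdge (w , b) (u , v))) →
                 Good′ (move b p) × E S′ (just w) (move b p)
      move-nbr gb wb (no differ) = gb , wb , differ
      move-nbr gb wb (yes (inj₁ (refl , refl))) = (gw , gb) , inj₁ refl
      move-nbr gb wb (yes (inj₂ (refl , refl))) = (gb , gw) , inj₂ refl

  subdivide-model : WallModel k S′
  subdivide-model = record
    { Good = Good′ ; Port = Port′ ; port = port′ ; port-injective = port-injective′
    ; lab = lab′ ; connected = connected′
    ; crossing = λ i j → let (w , row , col , ¬¬fork) = crossing i j
        in just w , row , col , λ none → ¬¬fork λ fork → fork′ (proj₁ row) fork none }

subdivision-model : ∀ {k G S} → WallModel k G → SubdivisionOf G S → WallModel k S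
subdivision-model model base = model
subdivision-model model (step sub u v e) = subdivide-model (subdivision-model model sub) u v e

wall⇒grid : ∀ {k S} → WallModel k S → GridModel k 3 S
wall⇒grid {S = S} model = record
  { Good = Good ; Port = Port ; port = port ; port-injective = port-injective
  ; Line = λ δ i → OnLine {S} Good lab δ (toℕ i) ; line-good = proj₁
  ; label = λ δ v _ → pred (lab δ v) ; line-label = λ on → F.zero , cong pred (proj₂ on)
  ; line-connected = connected
  ; crossing = λ i j none → let (v , row , col , ¬¬fork) = crossing i j
      in ¬¬fork λ fork → none (v , row , col , inj₁ fork) }
  where open WallModel model

module _ {k S L} (model : WallModel k S) (line : IsLineGraphOf S L) where
  open WallModel model
  open IsLineGraphOf line

  private
    end : Fin 2 → V L → V S
    end F.zero x = proj₁ (ends x)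
    end (F.suc F.zero) x = proj₂ (ends x)

    GoodEdge : V L → Set
    GoodEdge x = ∀ q → Good (end q x)

    Runs : V L → V S → V S → Set
    Runs x a b = SameEdge (ends x) (a , b)

    runs-edge : ∀ {x a b} → Runs x a b → E S a b
    runs-edge {x} (inj₁ (refl , refl)) = isEdge x
    runs-edge {x} (inj₂ (refl , refl)) = E-sym S (isEdge x)

    runs-good : ∀ {x a b} → GoodEdge x → Runs x a b → Good a × Good b
    runs-good g (inj₁ (refl , refl)) = g F.zero , g (F.suc F.zero)
    runs-good g (inj₂ (refl , refl)) = g (F.suc F.zero) , g F.zero

    good-runs : ∀ {x a b} → Good a → Good b → Runs x a b → GoodEdge x
    good-runs ga gb (inj₁ (refl , refl)) F.zero = ga
    good-runs ga gb (inj₁ (refl , refl)) (F.suc F.zero) = gb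
    good-runs ga gb (inj₂ (refl , refl)) F.zero = gb
    good-runs ga gb (inj₂ (refl , refl)) (F.suc F.zero) = ga

    runs-unique : ∀ {x y a b} → Runs x a b → Runs y a b → x ≡ y
    runs-unique (inj₁ (p , q)) (inj₁ (p′ , q′)) = inj _ _ (inj₁ (trans p (sym p′) , trans q (sym q′)))
    runs-unique (inj₁ (p , q)) (inj₂ (p′ , q′)) = inj _ _ (inj₂ (trans p (sym q′) , trans q (sym p′)))
    runs-unique (inj₂ (p , q)) (inj₁ (p′ , q′)) = inj _ _ (inj₂ (trans p (sym q′) , trans q (sym p′)))
    runs-unique (inj₂ (p , q)) (inj₂ (p′ , q′)) = inj _ _ (inj₁ (trans p (sym p′) , trans q (sym q′)))

    runs-share : ∀ {x y a b c} → Runs x a b → Runs y a c → Share (ends x) (ends y)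
    runs-share (inj₁ (p , _)) (inj₁ (q , _)) = inj₁ (trans p (sym q))
    runs-share (inj₁ (p , _)) (inj₂ (_ , q)) = inj₂ (inj₁ (trans p (sym q)))
    runs-share (inj₂ (_ , p)) (inj₁ (q , _)) = inj₂ (inj₂ (inj₁ (trans p (sym q))))
    runs-share (inj₂ (_ , p)) (inj₂ (_ , q)) = inj₂ (inj₂ (inj₂ (trans p (sym q))))

    -- A neighbouring edge is located by the end of `x` that it shares and by its port there, which
    -- gives two times three ports.
    LinePort : V L → V L → Fin 6 → Set
    LinePort x y r = ∃₂ λ q p → F.combine {2} {3} q p ≡ r × ∃ λ b → Runs y (end q x) b × Port (end q x) b p

    shared-end : ∀ {x y} → Share (ends x) (ends y) → ∃₂ λ q b → Runs y (end q x) b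
    shared-end (inj₁ p) = F.zero , _ , inj₁ (sym p , refl)
    shared-end (inj₂ (inj₁ p)) = F.zero , _ , inj₂ (refl , sym p)
    shared-end (inj₂ (inj₂ (inj₁ p))) = F.suc F.zero , _ , inj₁ (sym p , refl)
    shared-end (inj₂ (inj₂ (inj₂ p))) = F.suc F.zero , _ , inj₂ (refl , sym p)

    line-port : ∀ {x y} → GoodEdge x → GoodEdge y → E L x y → ∃ (LinePort x y)
    line-port {x} {y} gx gy xy with shared-end {x} {y} (proj₂ (Equivalence.to (adj x y) xy))
    ... | q , b , run with port (gx q) (proj₂ (runs-good gy run)) (runs-edge run)
    ...   | p , is-port = _ , q , p , refl , b , run , is-port

    line-port-injective : ∀ {x y z r} → GoodEdge x → GoodEdge y → GoodEdge z → E L x y → E L x z →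
                          LinePort x y r → LinePort x z r → y ≡ z
    line-port-injective gx gy gz _ _ (q , p , refl , b , run , is-port) (q′ , p′ , eq , b′ , run′ , is-port′)
      with FP.combine-injective q′ p′ q p eq
    ... | refl , refl with port-injective (gx q) (proj₂ (runs-good gy run)) (proj₂ (runs-good gz run′))
                             (runs-edge run) (runs-edge run′) is-port is-port′
    ...   | refl = runs-unique run run′

    module _ (δ : Bool) (i : Fin k) where
      On₁ = OnLine {S} Good lab δ (toℕ i)

      -- One end on the line suffices, so that any good edge at a crossing vertex lies on both lines
      -- through it.
      OnEdge : V L → Set
      OnEdge x = GoodEdge x × ∃ λ q → lab δ (end q x) ≡ suc (toℕ i)

      on-edge : ∀ {x a b} → On₁ a → Good b → Runs x a b → OnEdge x
      on-edge (ga , eq) gb run@(inj₁ (refl , refl)) = good-runs ga gb run , F.zero , eq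
      on-edge (ga , eq) gb run@(inj₂ (refl , refl)) = good-runs ga gb run , F.suc F.zero , eq

      line-step : ∀ {x y a b c} → OnEdge x → OnEdge y → Runs x a b → Runs y a c →
                  ¬ ¬ Star (Within L OnEdge) x y
      line-step {x} {y} ox oy run run′ none = ¬¬-excluded-middle {A = x ≡ y} λ where
        (yes refl) → none ε
        (no x≢y) → none ((Equivalence.from (adj x y) (x≢y , runs-share run run′) , ox , oy) ◅ ε)

      swap-run : ∀ {x a b} → Runs x a b → Runs x b a
      swap-run (inj₁ p) = inj₂ p
      swap-run (inj₂ p) = inj₁ p

      -- Consecutive edges of a walk share a vertex, so they are equal or adjacent in the line
      -- graph. Which of the two holds is undecided, whence the double negation.
      follow : ∀ {a c x y b d} → Star (Within S On₁) a c → OnEdge x → OnEdge y → Runs x a b → Runs y c d →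
               ¬ ¬ Star (Within L OnEdge) x y
      follow ε ox oy run run′ = line-step ox oy run run′
      follow ((e , oa , oa′) ◅ w) ox oy run run′ none with onto _ _ e
      ... | z , run-z = line-step ox oz run run-z λ w₁ →
                        follow w oz oy (swap-run run-z) run′ λ w₂ → none (w₁ ◅◅ w₂)
        where oz = on-edge oa (proj₁ oa′) run-z

      end-runs : ∀ q x → ∃ λ b → Runs x (end q x) b
      end-runs F.zero x = _ , inj₁ (refl , refl)
      end-runs (F.suc F.zero) x = _ , inj₂ (refl , refl)

      line-graph-connected : ∀ {x y} → OnEdge x → OnEdge y → ¬ ¬ Star (Within L OnEdge) x y
      line-graph-connected {x} {y} ox@(gx , q , eq) oy@(gy , q′ , eq′) none =
        connected δ i (gx q , eq) (gy q′ , eq′) λ w →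
        follow w ox oy (proj₂ (end-runs q x)) (proj₂ (end-runs q′ y)) none

    fork⇒triangle : ∀ {v} → Good v → (fork : Fork S Good v) →
      ∃ λ x → Runs x v (proj₁ fork F.zero) × Triangle L GoodEdge x
    fork⇒triangle {v} gv (a , a-inj , nbrs) =
      x F.zero , run F.zero , x (F.suc F.zero) , x (F.suc (F.suc F.zero)) ,
      good _ , good _ , link (λ ()) , link (λ ()) , link (λ ())
      where
      x : Fin 3 → V L
      x m = proj₁ (onto v (a m) (proj₂ (nbrs m)))
      run : ∀ m → Runs (x m) v (a m)
      run m = proj₂ (onto v (a m) (proj₂ (nbrs m)))
      good : ∀ m → GoodEdge (x m)
      good m = good-runs gv (proj₁ (nbrs m)) (run m)
      far-end : ∀ {y b c} → Runs y v b → Runs y v c → b ≡ c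
      far-end (inj₁ (_ , p)) (inj₁ (_ , q)) = trans (sym p) q
      far-end {y} (inj₁ (p , _)) (inj₂ (_ , q)) = ⊥-elim (E-irr S (subst₂ (E S) p q (isEdge y)))
      far-end {y} (inj₂ (_ , p)) (inj₁ (q , _)) = ⊥-elim (E-irr S (subst₂ (E S) q p (isEdge y)))
      far-end (inj₂ (p , _)) (inj₂ (q , _)) = trans (sym p) q
      link : ∀ {m m′} → m ≢ m′ → E L (x m) (x m′)
      link {m} {m′} m≢m′ = Equivalence.from (adj _ _)
        ( (λ eq → m≢m′ (a-inj (far-end (run m) (subst (λ z → Runs z v (a m′)) (sym eq) (run m′)))))
        , runs-share (run m) (run m′))

  line-grid : GridModel k 6 L
  line-grid = record
    { Good = GoodEdge ; Port = LinePort ; port = line-port ; port-injective = line-port-injective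
    ; Line = OnEdge ; line-good = proj₁
    ; label = λ δ x q → pred (lab δ (end q x)) ; line-label = λ (_ , q , eq) → q , cong pred eq
    ; line-connected = line-graph-connected
    ; crossing = λ i j none →
        let (v , row , col , ¬¬fork) = crossing i j
        in ¬¬fork λ fork →
           let (x , run , triangle) = fork⇒triangle (proj₁ row) fork
               far-good = proj₁ (proj₂ (proj₂ fork) F.zero)
           in none (x , on-edge false i row far-good run , on-edge true j col far-good run , inj₂ triangle) }

-- The wall

even-suc : ∀ n → Even n → ¬ Even (suc n)
even-suc (suc (suc n)) p q = even-suc n p q

even-or-suc : ∀ n → Even n ⊎ Even (suc n)
even-or-suc zero = inj₁ refl
even-or-suc (suc zero) = inj₂ refl
even-or-suc (suc (suc n)) = even-or-suc n

half-cases : ∀ c {j} → ⌊ c /2⌋ ≡ j → c ≡ j + j ⊎ c ≡ suc (j + j)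
half-cases zero refl = inj₁ refl
half-cases (suc zero) refl = inj₂ refl
half-cases (suc (suc c)) refl with half-cases c refl
... | inj₁ eq = inj₁ (cong suc (trans (cong suc eq) (sym (+-suc _ _))))
... | inj₂ eq = inj₂ (cong (suc ∘ suc) (trans eq (sym (+-suc _ _))))

triple : ∀ {A : Set} → A → A → A → Fin 3 → A
triple x y z F.zero = x
triple x y z (F.suc F.zero) = y
triple x y z (F.suc (F.suc F.zero)) = z

triple-injective : ∀ {A : Set} {x y z : A} → x ≢ y → x ≢ z → y ≢ z → Injective _≡_ _≡_ (triple x y z)
triple-injective _ _ _ {F.zero} {F.zero} _ = refl
triple-injective p _ _ {F.zero} {F.suc F.zero} eq = ⊥-elim (p eq)
triple-injective _ q _ {F.zero} {F.suc (F.suc F.zero)} eq = ⊥-elim (q eq)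
triple-injective p _ _ {F.suc F.zero} {F.zero} eq = ⊥-elim (p (sym eq))
triple-injective _ _ _ {F.suc F.zero} {F.suc F.zero} _ = refl
triple-injective _ _ r {F.suc F.zero} {F.suc (F.suc F.zero)} eq = ⊥-elim (r eq)
triple-injective _ q _ {F.suc (F.suc F.zero)} {F.zero} eq = ⊥-elim (q (sym eq))
triple-injective _ _ r {F.suc (F.suc F.zero)} {F.suc F.zero} eq = ⊥-elim (r (sym eq))
triple-injective _ _ _ {F.suc (F.suc F.zero)} {F.suc (F.suc F.zero)} _ = refl

module _ (k : ℕ) where
  private
    t = suc (suc k)

    2t≡ : 2 * t ≡ 4 + (k + k)
    2t≡ rewrite +-identityʳ k | +-suc k (suc k) | +-suc k k = refl

    row col : V (Wall t) → ℕ
    row v = toℕ (proj₁ (proj₁ v))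
    col v = toℕ (proj₂ (proj₁ v))

    Corner : ℕ → ℕ → Set
    Corner a b = (a ≡ 0 × b ≡ 2 * t ∸ 1)
               ⊎ (a ≡ t ∸ 1 × ((t % 2 ≡ 1 × b ≡ 0) ⊎ (t % 2 ≡ 0 × b ≡ 2 * t ∸ 1)))

    corner? : ∀ a b → Dec (Corner a b)
    corner? a b = ((a ≟ 0) ×-dec (b ≟ 2 * t ∸ 1)) ⊎-dec
      ((a ≟ t ∸ 1) ×-dec (((t % 2 ≟ 1) ×-dec (b ≟ 0)) ⊎-dec ((t % 2 ≟ 0) ×-dec (b ≟ 2 * t ∸ 1))))

    -- Without function extensionality a wall vertex is not determined by its coordinates,
    -- so one refutation of WallCorner is singled out.
    canonical : ∀ a b → ¬ Corner a b → ¬ Corner a b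
    canonical a b p with corner? a b
    ... | yes q = ⊥-elim (p q)
    ... | no q = q

    canonical-unique : ∀ a b p q → canonical a b p ≡ canonical a b q
    canonical-unique a b p q with corner? a b
    ... | yes c = ⊥-elim (p c)
    ... | no _ = refl

    Good : V (Wall t) → Set
    Good ((i , c) , p) = p ≡ canonical (toℕ i) (toℕ c) p

    good-unique : ∀ {v w} → Good v → Good w → row v ≡ row w → col v ≡ col w → v ≡ w
    good-unique {(i , c) , p} {(i′ , c′) , p′} gv gw r≡ c≡
      with FP.toℕ-injective r≡ | FP.toℕ-injective c≡
    ... | refl | refl = cong ((i , c) ,_) (trans gv (trans (canonical-unique _ _ p p′) (sym gw)))

    vertexAt : ∀ {a b} → a < t → b < 2 * t → ¬ Corner a b → ∃ λ v → Good v × row v ≡ a × col v ≡ b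
    vertexAt {a} {b} a< b< nc =
      ((fromℕ< a< , fromℕ< b<) , canonical _ _ nc′) , canonical-unique _ _ nc′ (canonical _ _ nc′) ,
      FP.toℕ-fromℕ< a< , FP.toℕ-fromℕ< b<
      where
      nc′ : ¬ Corner (toℕ (fromℕ< a<)) (toℕ (fromℕ< b<))
      nc′ = subst₂ (λ x y → ¬ Corner x y) (sym (FP.toℕ-fromℕ< a<)) (sym (FP.toℕ-fromℕ< b<)) nc

    inner-row : ∀ (i : Fin k) {b} → ¬ Corner (suc (toℕ i)) b
    inner-row i (inj₂ (eq , _)) = <⇒≢ (FP.toℕ<n i) (suc-injective eq)

    row< : ∀ (i : Fin k) → suc (suc (toℕ i)) < t
    row< i = s≤s (s≤s (FP.toℕ<n i))

    -- Vertical line `j` consists of the columns `2* j` and `2* j + 1`; the shift by one pair skips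
    -- columns 0 and 1, where a corner may be deleted.
    2* : ℕ → ℕ
    2* j = suc j + suc j

    2*-bound : ∀ (j : Fin k) → 3 + 2* (toℕ j) ≤ 2 * t ∸ 1
    2*-bound j = subst (λ m → 3 + 2* (toℕ j) ≤ m ∸ 1) (sym 2t≡) (+-monoʳ-≤ 3 (+-mono-≤ (FP.toℕ<n j) (FP.toℕ<n j)))

    module _ (j : Fin k) {b} (half : b ≡ 2* (toℕ j) ⊎ b ≡ suc (2* (toℕ j))) where
      col-bound : suc b < 2 * t ∸ 1
      col-bound = ≤-trans (go half) (2*-bound j)
        where
        go : b ≡ 2* (toℕ j) ⊎ b ≡ suc (2* (toℕ j)) → 2 + b ≤ 3 + 2* (toℕ j)
        go (inj₁ refl) = n≤1+n _
        go (inj₂ refl) = ≤-refl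

      inner-col : ∀ {a} → ¬ Corner a b
      inner-col (inj₁ (_ , eq)) = <⇒≢ (<-trans (n<1+n b) col-bound) eq
      inner-col (inj₂ (_ , inj₁ (_ , b≡0))) =
        [ (λ eq → 0≢1+n (trans (sym b≡0) eq)) , (λ eq → 0≢1+n (trans (sym b≡0) eq)) ]′ half
      inner-col (inj₂ (_ , inj₂ (_ , eq))) = <⇒≢ (<-trans (n<1+n b) col-bound) eq

      col< : suc b < 2 * t
      col< = ≤-trans col-bound (m∸n≤m (2 * t) 1)

    Side : Fin 3 → ℕ → ℕ → ℕ → ℕ → Set
    Side F.zero i j k l = i ≡ k × suc l ≡ j
    Side (F.suc F.zero) i j k l = i ≡ k × suc j ≡ l
    Side (F.suc (F.suc F.zero)) i j k l = j ≡ l × ((suc i ≡ k × Even (i + j)) ⊎ (suc k ≡ i × Even (k + l)))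

    side : ∀ {i j k l} → WallAdjℕ i j k l → ∃ λ p → Side p i j k l
    side (inj₁ (r , inj₁ e)) = F.suc F.zero , r , e
    side (inj₁ (r , inj₂ e)) = F.zero , r , e
    side (inj₂ e) = F.suc (F.suc F.zero) , e

    -- The vertical neighbour is unique because edges to both adjacent rows would need two
    -- consecutive numbers to be even.
    side-unique : ∀ p {i j k l k′ l′} → Side p i j k l → Side p i j k′ l′ → k ≡ k′ × l ≡ l′
    side-unique F.zero (refl , refl) (refl , refl) = refl , refl
    side-unique (F.suc F.zero) (refl , refl) (refl , refl) = refl , refl
    side-unique (F.suc (F.suc F.zero)) (refl , inj₁ (refl , _)) (refl , inj₁ (refl , _)) = refl , refl
    side-unique (F.suc (F.suc F.zero)) {j = j} {k′ = k′} (refl , inj₁ (refl , e)) (refl , inj₂ (refl , e′)) =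
      ⊥-elim (even-suc (k′ + j) e′ e)
    side-unique (F.suc (F.suc F.zero)) {j = j} {k} (refl , inj₂ (refl , e)) (refl , inj₁ (refl , e′)) =
      ⊥-elim (even-suc (k + j) e e′)
    side-unique (F.suc (F.suc F.zero)) (refl , inj₂ (refl , _)) (refl , inj₂ (refl , _)) = refl , refl

    lab : Bool → V (Wall t) → ℕ
    lab false v = row v
    lab true v = ⌊ col v /2⌋

    On : Bool → Fin k → V (Wall t) → Set
    On δ i = OnLine {Wall t} Good lab δ (toℕ i)

    Path : Bool → Fin k → V (Wall t) → V (Wall t) → Set
    Path δ i = Star (Within (Wall t) (On δ i))

    same-place : ∀ δ i {v w} → On δ i v → On δ i w → row v ≡ row w → col v ≡ col w → Path δ i v w
    same-place δ i {v} (gv , _) (gw , _) r≡ c≡ = subst (Path δ i v) (good-unique gv gw r≡ c≡) ε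

    adjacent : ∀ v w {a b c d} → row v ≡ a → col v ≡ b → row w ≡ c → col w ≡ d → WallAdjℕ a b c d → E (Wall t) v w
    adjacent _ _ refl refl refl refl e = e

    row-vertex : ∀ i {b} → b < 2 * t → ∃ λ v → On false i v × col v ≡ b
    row-vertex i b< with vertexAt (<-trans (n<1+n _) (row< i)) b< (inner-row i)
    ... | v , gv , r , c = v , (gv , r) , c

    row-walk : ∀ i m {v w} → On false i v → On false i w → col v ≡ m → col w ≡ 0 → Path false i v w
    row-walk i zero ov ow c c₀ = same-place false i ov ow (trans (proj₂ ov) (sym (proj₂ ow))) (trans c (sym c₀))
    row-walk i (suc m) {v} ov ow c c₀
      with row-vertex i {m} (≤-trans (s≤s (n≤1+n m)) (subst (_< 2 * t) c (FP.toℕ<n (proj₂ (proj₁ v)))))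
    ... | x , ox , cx = (adjacent v x (proj₂ ov) c (proj₂ ox) cx (inj₁ (refl , inj₂ refl)) , ov , ox)
                        ◅ row-walk i m ox ow cx c₀

    column-vertex : ∀ j {a b} → a < t → b ≡ 2* (toℕ j) ⊎ b ≡ suc (2* (toℕ j)) →
                    ∃ λ v → On true j v × row v ≡ a × col v ≡ b
    column-vertex j {a} {b} a< half with vertexAt a< (<-trans (n<1+n b) (col< j half)) (inner-col j half)
    ... | v , gv , r , c = v , (gv , trans (cong ⌊_/2⌋ c) (halve half)) , r , c
      where
      halve : ∀ {b} → b ≡ 2* (toℕ j) ⊎ b ≡ suc (2* (toℕ j)) → ⌊ b /2⌋ ≡ suc (toℕ j)
      halve (inj₁ refl) = sym (n≡⌊n+n/2⌋ (suc (toℕ j)))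
      halve (inj₂ refl) = sym (n≡⌈n+n/2⌉ (suc (toℕ j)))

    pair-walk : ∀ j {v w} → On true j v → On true j w → row v ≡ row w → Path true j v w
    pair-walk j {v} {w} ov ow r≡ with half-cases (col v) (proj₂ ov) | half-cases (col w) (proj₂ ow)
    ... | inj₁ p | inj₁ q = same-place true j ov ow r≡ (trans p (sym q))
    ... | inj₂ p | inj₂ q = same-place true j ov ow r≡ (trans p (sym q))
    ... | inj₁ p | inj₂ q = (inj₁ (r≡ , inj₁ (trans (cong suc p) (sym q))) , ov , ow) ◅ ε
    ... | inj₂ p | inj₁ q = (inj₁ (r≡ , inj₂ (trans (cong suc q) (sym p))) , ov , ow) ◅ ε

    -- Between two consecutive rows the vertical edges occupy columns of one parity. A pair of
    -- adjacent columns always contains one of them, while a single column would not be connected.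
    even-column : ∀ (j : Fin k) m → ∃ λ b → (b ≡ 2* (toℕ j) ⊎ b ≡ suc (2* (toℕ j))) × Even (m + b)
    even-column j m with even-or-suc (m + 2* (toℕ j))
    ... | inj₁ e = _ , inj₁ refl , e
    ... | inj₂ e = _ , inj₂ refl , subst Even (sym (+-suc m _)) e

    column-walk : ∀ j m {v w} → On true j v → On true j w → row v ≡ m → row w ≡ 0 → Path true j v w
    column-walk j zero ov ow r r₀ = pair-walk j ov ow (trans r (sym r₀))
    column-walk j (suc m) {v} ov ow r r₀ with even-column j m
    ... | b , half , e with subst (_< t) r (FP.toℕ<n (proj₁ (proj₁ v)))
    ...   | m< with column-vertex j m< half | column-vertex j (<-trans (n<1+n m) m<) half
    ...     | x , ox , rx , cx | y , oy , ry , cy =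
      pair-walk j ov ox (trans r (sym rx)) ◅◅
      ((adjacent x y rx cx ry cy (inj₂ (refl , inj₂ (refl , e))) , ox , oy) ◅ column-walk j m oy ow ry r₀)

    symmetric : ∀ δ i {v w} → Path δ i v w → Path δ i w v
    symmetric δ i = Star.reverse (λ {x} {y} → Within-sym (Wall t) {On δ i} {x} {y})

    connected : ∀ δ (i : Fin k) {u v} → On δ i u → On δ i v → Path δ i u v
    connected false i ou ov =
      let (w , ow , c) = row-vertex i z<s
      in row-walk i _ ou ow refl c ◅◅ symmetric false i (row-walk i _ ov ow refl c)
    connected true j ou ov =
      let (w , ow , r , _) = column-vertex j z<s (inj₁ refl)
      in column-walk j _ ou ow refl r ◅◅ symmetric true j (column-walk j _ ov ow refl r)

    vertical-nbr : ∀ (i j : Fin k) → ∃ λ a → a < t × a ≢ suc (toℕ i) ×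
                   WallAdjℕ (suc (toℕ i)) (2* (toℕ j)) a (2* (toℕ j))
    vertical-nbr i j with even-or-suc (toℕ i + 2* (toℕ j))
    ... | inj₁ e = toℕ i , <-trans (n<1+n _) (<-trans (n<1+n _) (row< i)) , (λ eq → 1+n≢n (sym eq)) ,
                   inj₂ (refl , inj₂ (refl , e))
    ... | inj₂ e = suc (suc (toℕ i)) , row< i , 1+n≢n , inj₂ (refl , inj₁ (refl , e))

    fork : ∀ i j {v} → Good v → row v ≡ suc (toℕ i) → col v ≡ 2* (toℕ j) → Fork (Wall t) Good v
    fork i j {v} gv rv cv with vertical-nbr i j
    ... | a , a< , a≢ , vert
      -- `toℕ j + suc (toℕ j)` is the column just left of `2* (toℕ j)`, written so that its
      -- successor reduces to the latter.
      with row-vertex i {toℕ j + suc (toℕ j)} (<-trans (n<1+n _) (<-trans (n<1+n _) (col< j (inj₁ refl))))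
         | row-vertex i {suc (2* (toℕ j))} (col< j (inj₁ refl))
         | column-vertex j a< (inj₁ refl)
    ... | x , (gx , rx) , cx | y , (gy , ry) , cy | z , (gz , _) , rz , cz =
      triple x y z , triple-injective x≢y x≢z y≢z , nbr-good
      where
      x≢y : x ≢ y
      x≢y refl = <⇒≢ (<-trans (n<1+n _) (n<1+n _)) (trans (sym cx) cy)
      x≢z : x ≢ z
      x≢z refl = a≢ (trans (sym rz) rx)
      y≢z : y ≢ z
      y≢z refl = a≢ (trans (sym rz) ry)
      nbr-good : ∀ m → Good (triple x y z m) × E (Wall t) v (triple x y z m)
      nbr-good F.zero = gx , adjacent v x rv cv rx cx (inj₁ (refl , inj₂ refl))
      nbr-good (F.suc F.zero) = gy , adjacent v y rv cv ry cy (inj₁ (refl , inj₁ refl))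
      nbr-good (F.suc (F.suc F.zero)) = gz , adjacent v z rv cv rz cz vert

  wall-model : WallModel k (Wall (suc (suc k)))
  wall-model = record
    { Good = Good
    ; Port = λ v w p → Side p (row v) (col v) (row w) (col w)
    ; port = λ _ _ → side
    ; port-injective = λ {_} {_} {_} {p} _ ga gb _ _ s s′ →
        let (r≡ , c≡) = side-unique p s s′ in good-unique ga gb r≡ c≡
    ; lab = lab
    ; connected = λ δ i ou ov none → none (connected δ i ou ov)
    ; crossing = λ i j → let (v , ov , r , c) = column-vertex j (<-trans (n<1+n _) (row< i)) (inj₁ refl)
        in v , (proj₁ ov , r) , ov , λ none → none (fork i j (proj₁ ov) r c) }

-- Short cycles and distant hubs

argmax : ∀ {m} (h : Fin (suc m) → ℕ) → ∃ λ i → ∀ j → h j ≤ h i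
argmax {zero} h = F.zero , λ { F.zero → ≤-refl }
argmax {suc m} h with argmax (h ∘ F.suc)
... | i , max with ≤-total (h F.zero) (h (F.suc i))
...   | inj₁ le = F.suc i , λ { F.zero → le ; (F.suc j) → max j }
...   | inj₂ ge = F.zero , λ { F.zero → ≤-refl ; (F.suc j) → ≤-trans (max j) ge }

module _ (G : Graph) {m} (p : Fin (suc m) → V G) (2≤m : 2 ≤ m) (inj : Injective _≡_ _≡_ p)
         (edge : ∀ (i : Fin m) → E G (p (inject₁ i)) (p (F.suc i)))
         (close : E G (p (fromℕ m)) (p F.zero)) where

  two-cycle-nbrs : ∀ i → ∃₂ λ j k → j ≢ k × E G (p i) (p j) × E G (p i) (p k)
  two-cycle-nbrs i = go 2≤m edge close
    where
    go : 2 ≤ m → (∀ (i : Fin m) → E G (p (inject₁ i)) (p (F.suc i))) → E G (p (fromℕ m)) (p F.zero) →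
         ∃₂ λ j k → j ≢ k × E G (p i) (p j) × E G (p i) (p k)
    go (s≤s (s≤s z≤n)) edge close with view i
    ... | ‵fromℕ = F.zero , inject₁ (fromℕ _) , (λ ()) , close , E-sym G (edge (fromℕ _))
    ... | ‵inject₁ F.zero = fromℕ _ , F.suc F.zero , (λ ()) , E-sym G close , edge F.zero
    ... | ‵inject₁ (F.suc j) = inject₁ (inject₁ j) , F.suc (F.suc j) , differ , E-sym G (edge (inject₁ j)) , edge (F.suc j)
      where
      differ : inject₁ (inject₁ j) ≢ F.suc (F.suc j)
      differ eq = <⇒≢ (n≤1+n (suc (toℕ j))) (trans (sym (trans (FP.toℕ-inject₁ _) (FP.toℕ-inject₁ j))) (cong toℕ eq))

  -- A vertex of maximal height on a cycle has two neighbours that are not higher.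
  no-cycle-if-unique-lower : (h : V G → ℕ) →
    (∀ i j k → E G (p i) (p j) → E G (p i) (p k) → h (p j) ≤ h (p i) → h (p k) ≤ h (p i) → p j ≡ p k) → ⊥
  no-cycle-if-unique-lower h unique with argmax (h ∘ p)
  ... | i , max with two-cycle-nbrs i
  ...   | j , k , j≢k , ij , ik = j≢k (inj (unique i j k ij ik (max j) (max k)))

∣-∣-grow : ∀ c q → q ≤ c → ∣ c - q ∣ < ∣ suc c - q ∣
∣-∣-grow c zero _ = s≤s (≤-reflexive (∣-∣-identityʳ c))
∣-∣-grow (suc c) (suc q) (s≤s le) = ∣-∣-grow c q le

∣-∣-shrink : ∀ c q → suc c ≤ q → ∣ suc c - q ∣ < ∣ c - q ∣
∣-∣-shrink zero (suc q) _ = n<1+n q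
∣-∣-shrink (suc c) (suc q) (s≤s le) = ∣-∣-shrink c q le

module _ (n L s : ℕ) (s≤1 : s ≤ 1) (2≤L : 2 ≤ L) where
  open Array n L s s≤1 2≤L

  pos-spread : ∀ m (p : Fin (suc m) → Vertex) → (∀ (i : Fin m) → Adj (p (inject₁ i)) (p (F.suc i))) →
               ∀ a b → pos (p a) ≤ pos (p b) + m
  pos-spread m p edge F.zero F.zero = m≤m+n _ m
  pos-spread (suc m) p edge F.zero (F.suc b) =
    ≤-trans (pos-step {p (F.suc F.zero)} {p F.zero} (Adj-sym {p F.zero} {p (F.suc F.zero)} (edge F.zero)))
      (≤-trans (s≤s (pos-spread m (p ∘ F.suc) (edge ∘ F.suc) F.zero b)) (≤-reflexive (sym (+-suc _ m))))
  pos-spread (suc m) p edge (F.suc a) F.zero =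
    ≤-trans (pos-spread m (p ∘ F.suc) (edge ∘ F.suc) a F.zero)
      (≤-trans (+-monoˡ-≤ m (pos-step {p F.zero} {p (F.suc F.zero)} (edge F.zero))) (≤-reflexive (sym (+-suc _ m))))
  pos-spread (suc m) p edge (F.suc a) (F.suc b) =
    ≤-trans (pos-spread m (p ∘ F.suc) (edge ∘ F.suc) a b) (+-monoʳ-≤ _ (n≤1+n m))

  -- Distinct hubs have positions at least `L` apart, and `m` edges change the position by at most
  -- `m`.
  hubs-far : ∀ {m} (p : Fin (suc m) → Vertex) → (∀ (i : Fin m) → Adj (p (inject₁ i)) (p (F.suc i))) →
             m < L → ∀ {a b j j′} → p a ≡ hub j → p b ≡ hub j′ → j ≡ j′
  hubs-far {m} p edge m<L {a} {b} {j} {j′} pa pb with j FP.≟ j′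
  ... | yes eq = eq
  ... | no j≢j′ = ⊥-elim (<⇒≱ m<L (far (≤-total (pos (hub j)) (pos (hub j′)))))
    where
    near : ∀ {a b j j′} → p a ≡ hub j → p b ≡ hub j′ → pos (hub j′) ≤ pos (hub j) + m
    near pa pb = subst₂ (λ x y → pos y ≤ pos x + m) pa pb (pos-spread m p edge _ _)
    far : pos (hub j) ≤ pos (hub j′) ⊎ pos (hub j′) ≤ pos (hub j) → L ≤ m
    far (inj₁ le) = +-cancelˡ-≤ (pos (hub j)) L m (≤-trans (hub≢⇒far j≢j′ le) (near pa pb))
    far (inj₂ le) = +-cancelˡ-≤ (pos (hub j′)) L m (≤-trans (hub≢⇒far (j≢j′ ∘ sym) le) (near pb pa))

  -- 17 = 2 + 15 and 15 > 2 · (1 + 6): in the line graph a cut has at most 1 + 6 good vertices,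
  -- each on at most two lines of either direction, and the wall has two more rows than lines.
  array-clean : Clean 17 array
  array-clean = no-complete , no-bipartite , no-wall , no-line
    where
    no-complete : ¬ Embeds (Complete 17) array
    no-complete (f , f-inj , f-edge) =
      -- Vertices 1 to 4 serve as neighbours of vertex 0, and vertices 2 to 5 as neighbours of
      -- vertex 1.
      no-big-edge {f F.zero} {f (F.suc F.zero)} (push (λ ()))
        (λ m → f (F.suc (m ↑ˡ 12))) (λ m → f (F.suc (F.suc (m ↑ˡ 11))))
        (FP.↑ˡ-injective 12 _ _ ∘ FP.suc-injective ∘ f-inj)
        (FP.↑ˡ-injective 11 _ _ ∘ FP.suc-injective ∘ FP.suc-injective ∘ f-inj)
        (λ m → push (λ ())) (λ m → push (λ ()))
      where
      push : ∀ {u v} → u ≢ v → Adj (f u) (f v)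
      push = Equivalence.to (f-edge _ _)
    no-bipartite : ¬ Embeds (CompleteBipartite 17) array
    no-bipartite (f , f-inj , f-edge) =
      no-big-edge {f (inj₁ F.zero)} {f (inj₂ F.zero)} (Equivalence.to (f-edge _ _) _)
        (λ m → f (inj₂ (m ↑ˡ 13))) (λ m → f (inj₁ (m ↑ˡ 13)))
        (FP.↑ˡ-injective 13 _ _ ∘ inj₂-injective ∘ f-inj)
        (FP.↑ˡ-injective 13 _ _ ∘ inj₁-injective ∘ f-inj)
        (λ m → Equivalence.to (f-edge _ _) _) (λ m → Equivalence.to (f-edge _ _) _)
    no-wall : ∀ S → SubdivisionOf (Wall 17) S → ¬ Embeds S array
    no-wall S sub = no-grid-model n L s s≤1 2≤L (wall⇒grid (subdivision-model (wall-model 15) sub)) (m≤m+n 8 6)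
    no-line : ∀ S L → SubdivisionOf (Wall 17) S → IsLineGraphOf S L → ¬ Embeds L array
    no-line S L′ sub line =
      no-grid-model n L s s≤1 2≤L (line-grid (subdivision-model (wall-model 15) sub) line) ≤-refl

module _ (n L : ℕ) (2≤L : 2 ≤ L) where
  open Array n L 0 z≤n 2≤L

  block-≡ : ∀ {j c} → Block j c → c ≡ j * L
  block-≡ (lo , hi) = ≤-antisym (≤-trans hi (≤-reflexive (+-identityʳ _))) lo

  -- By `hubs-far` the cycle meets at most one hub. The height is the column if there is no hub and
  -- the distance from the hub otherwise; either way a vertex of the cycle has at most one neighbour
  -- on it that is not higher.
  array-no-short-cycle : ∀ m (p : Fin (suc m) → Vertex) → m < L → 2 ≤ m → Injective _≡_ _≡_ p →
    (∀ (i : Fin m) → Adj (p (inject₁ i)) (p (F.suc i))) → ¬ Adj (p (fromℕ m)) (p F.zero)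
  array-no-short-cycle m p m<L 2≤m inj edge close with FP.any? (λ i → hub? (p i))
    where
    hub? : ∀ v → Dec (∃ λ j → v ≡ hub j)
    hub? (cell _ _) = no λ ()
    hub? (hub j) = yes (j , refl)
  ... | no no-hub = no-cycle-if-unique-lower array p 2≤m inj edge close pos λ i j k →
          unique (p i) (p j) (p k) (λ h eq → no-hub (i , h , eq)) (λ h eq → no-hub (j , h , eq)) (λ h eq → no-hub (k , h , eq))
    where
    unique : ∀ x y z → (∀ h → x ≢ hub h) → (∀ h → y ≢ hub h) → (∀ h → z ≢ hub h) → Adj x y → Adj x z →
             pos y ≤ pos x → pos z ≤ pos x → y ≡ z
    unique (hub h) y z hx _ _ _ _ _ _ = ⊥-elim (hx h refl)
    unique (cell i c) y z _ hy hz xy xz y≤ z≤ =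
      nbr-injective (is-left hy y≤ (proj₂ (nbr {v = y} xy))) (is-left hz z≤ (proj₂ (nbr {v = z} xz)))
      where
      is-left : ∀ {v κ} → (∀ h → v ≢ hub h) → pos v ≤ toℕ c → Nbr i c v κ → Nbr i c v F.zero
      is-left _ _ (left e) = left e
      is-left _ v≤ (right e) = ⊥-elim (<⇒≱ (≤-reflexive e) v≤)
      is-left hv _ (up {j} _) = ⊥-elim (hv j refl)
  ... | yes (i₀ , j₀ , at-hub) = no-cycle-if-unique-lower array p 2≤m inj edge close height λ i j k →
          unique (p i) (p j) (p k) (only i) (only j) (only k)
    where
    q = toℕ j₀ * L
    height : Vertex → ℕ
    -- The `suc` puts the hub strictly below all cells, so a hub has no neighbour that is not
    -- higher.
    height (cell i c) = suc ∣ toℕ c - q ∣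
    height (hub _) = 0
    only : ∀ i h → p i ≡ hub h → h ≡ j₀
    only i h eq = hubs-far n L 0 z≤n 2≤L p edge m<L eq at-hub
    unique : ∀ x y z → (∀ h → x ≡ hub h → h ≡ j₀) → (∀ h → y ≡ hub h → h ≡ j₀) → (∀ h → z ≡ hub h → h ≡ j₀) →
             Adj x y → Adj x z → height y ≤ height x → height z ≤ height x → y ≡ z
    unique (hub h) (cell _ _) z _ _ _ _ _ () _
    unique (cell i c) y z _ hy hz xy xz y≤ z≤ with kind
      where
      -- The only way not to climb leads towards the hub: right before its column, up at that
      -- column, left after it.
      kind : ∃ λ κ → ∀ {v κ′} → (∀ h → v ≡ hub h → h ≡ j₀) → height v ≤ height (cell i c) → Nbr i c v κ′ → κ′ ≡ κ
      kind with <-cmp (toℕ c) q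
      ... | tri< c<q _ _ = _ , λ where
              _ v≤ (left {c′} e) → ⊥-elim (<⇒≱ (subst (λ d → ∣ d - q ∣ < ∣ toℕ c′ - q ∣) e
                  (∣-∣-shrink (toℕ c′) q (≤-trans (≤-reflexive e) (<⇒≤ c<q)))) (≤-pred v≤))
              _ _ (right _) → refl
              hv _ (up {j} b) → ⊥-elim (<⇒≢ c<q (trans (block-≡ {toℕ j} b) (cong (λ h → toℕ h * L) (hv j refl))))
      ... | tri≈ _ c≡q _ = _ , λ where
              _ v≤ (left {c′} e) → ⊥-elim (<⇒≱ (subst (λ d → ∣ d - q ∣ < ∣ toℕ c′ - q ∣) e
                  (∣-∣-shrink (toℕ c′) q (≤-reflexive (trans e c≡q)))) (≤-pred v≤))
              _ v≤ (right {c′} e) → ⊥-elim (<⇒≱ (subst (λ d → ∣ toℕ c - q ∣ < ∣ d - q ∣) e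
                  (∣-∣-grow (toℕ c) q (≤-reflexive (sym c≡q)))) (≤-pred v≤))
              _ _ (up _) → refl
      ... | tri> _ _ c>q = _ , λ where
              _ _ (left _) → refl
              _ v≤ (right {c′} e) → ⊥-elim (<⇒≱ (subst (λ d → ∣ toℕ c - q ∣ < ∣ d - q ∣) e
                  (∣-∣-grow (toℕ c) q (<⇒≤ c>q))) (≤-pred v≤))
              hv _ (up {j} b) → ⊥-elim (<⇒≢ c>q (sym (trans (block-≡ {toℕ j} b) (cong (λ h → toℕ h * L) (hv j refl)))))
    ... | κ , is-κ with nbr {v = y} xy | nbr {v = z} xz
    ...   | _ , ny | _ , nz with is-κ hy y≤ ny | is-κ hz z≤ nz
    ...     | refl | refl = nbr-injective ny nz

-- The shape of `H`: no cycle and one branch vertex per component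

array-free⇒⊥ : ∀ {H} → CleanClass (Free H) → ∀ L s (s≤1 : s ≤ 1) (2≤L : 2 ≤ L) →
               (∀ n → ¬ Embeds H (Array.array n L s s≤1 2≤L)) → ⊥
array-free⇒⊥ clean L s s≤1 2≤L free =
  let (w , bounded) = clean 17 (s≤s z≤n)
      n = 2 + w
  in Array.array-treewidth n L s s≤1 2≤L w ≤-refl
       (bounded (Array.array n L s s≤1 2≤L) (Array.array-finite n L s s≤1 2≤L) (free n) (array-clean n L s s≤1 2≤L))

acyclic⇒no-triangle : ∀ {H} → Acyclic H → ∀ {u a b} → E H u a → E H a b → ¬ E H b u
acyclic⇒no-triangle {H} acyclic {u} {a} {b} ua ab bu =
  acyclic 2 (triple u a b) ≤-refl (triple-injective (distinct ua) (distinct bu ∘ sym) (distinct ab))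
    (λ { F.zero → ua ; (F.suc F.zero) → ab }) bu
  where
  distinct : ∀ {x y} → E H x y → x ≢ y
  distinct e refl = E-irr H e

-- If the centre were a cell, `adjacent-nbrs` would make two of its three neighbours adjacent, and
-- the induced embedding would carry this triangle back to the acyclic `H`.
claw-centre-is-hub : ∀ {H} → Acyclic H → ∀ n L (2≤L : 2 ≤ L) → let open Array n L 1 ≤-refl 2≤L in
  (emb : Embeds H array) → ∀ {u} → DegGt2 H u → ∃ λ j → proj₁ emb u ≡ hub j
claw-centre-is-hub {H} acyclic n L 2≤L (f , f-inj , f-edge) {u} (a , b , c , ua , ub , uc , a≢b , a≢c , b≢c)
  = go (f u) refl
  where
  open Array n L 1 ≤-refl 2≤L
  nbrs = triple a b c
  u-nbr : ∀ m → E H u (nbrs m)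
  u-nbr F.zero = ua
  u-nbr (F.suc F.zero) = ub
  u-nbr (F.suc (F.suc F.zero)) = uc
  go : ∀ x → f u ≡ x → ∃ λ j → f u ≡ hub j
  go (hub j) eq = j , eq
  go (cell i k) eq
    with adjacent-nbrs ≤-refl (f ∘ nbrs) (triple-injective a≢b a≢c b≢c ∘ f-inj)
           (λ m → subst (λ x → Adj x (f (nbrs m))) eq (Equivalence.to (f-edge _ _) (u-nbr m)))
  ... | m , m′ , e = ⊥-elim (acyclic⇒no-triangle {H} acyclic (u-nbr m) (Equivalence.from (f-edge _ _) e) (E-sym H (u-nbr m′)))

theorem3p3 : (H : Graph) → Finite H → CleanClass (Free H) → SubdividedStarForest H
theorem3p3 H fin clean = acyclic , one-centre
  where
  acyclic : Acyclic H
  acyclic m p 2≤m inj edge close =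
    -- The cycle has `suc m` vertices and its path has `m` edges, so `L = suc m` is just large
    -- enough for `m < L`.
    array-free⇒⊥ {H} clean (suc m) 0 z≤n (≤-trans 2≤m (n≤1+n m)) λ n (f , f-inj , f-edge) →
      array-no-short-cycle n (suc m) _ m (f ∘ p) ≤-refl 2≤m (inj ∘ f-inj)
        (λ i → Equivalence.to (f-edge _ _) (edge i)) (Equivalence.to (f-edge _ _) close)

  one-centre : ∀ u v → DegGt2 H u → DegGt2 H v → Reachable H u v → u ≡ v
  one-centre u v du dv (m , p , p₀ , pₘ , _ , edge) with finite⇒≟ {H} fin u v
  ... | yes eq = eq
  -- `2 + m` exceeds the length `m` of the walk and stays at least two even when `m` is zero.
  ... | no u≢v = ⊥-elim (array-free⇒⊥ {H} clean (2 + m) 1 ≤-refl (s≤s (s≤s z≤n)) λ n emb →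
    let (f , f-inj , f-edge) = emb
        (j , fu) = claw-centre-is-hub {H} acyclic n (2 + m) _ emb du
        (j′ , fv) = claw-centre-is-hub {H} acyclic n (2 + m) _ emb dv
        j≡j′ = hubs-far n (2 + m) 1 ≤-refl (s≤s (s≤s z≤n)) (f ∘ p) (λ i → Equivalence.to (f-edge _ _) (edge i))
                 (n≤1+n (suc m)) (trans (cong f p₀) fu) (trans (cong f pₘ) fv)
    in u≢v (f-inj (trans fu (trans (cong inj₂ j≡j′) (sym fv)))))
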